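{- Let $\langle B_n\rangle_{n=0}^\infty$ be an enumeration of the finite image partition regular matrices with rational entries. Let $p$ be a minimal idempotent in $(\beta\mathbb N,+)$ and let $A\in p$. Then there exist $b\in\mathbb N$ and a sequence $\langle Y_n\rangle_{n=0}^\infty$ in $\mathcal P_f(\mathbb N)$ such that each $Y_n$ is the set of entries of an image of $B_n$ (that is, with $B_n$ a $u(n)\times v(n)$ matrix, $Y_n$ is the set of entries of $B_n\vec x$ for some $\vec x\in\mathbb N^{v(n)}$) and $$FS(\langle Y_n\rangle_{n=0}^\infty)\cup\big(b+MT(\langle 2,1\rangle,\langle Y_n\rangle_{n=0}^\infty)\big)\subseteq A.$$
   Context: $\mathbb N=\{1,2,3,\ldots\}$, $\omega=\{0,1,2,\ldots\}$. For a set $X$, $\mathcal P_f(X)$ is the set of finite nonempty subsets of $X$. For $F,G\in\mathcal P_f(\omega)$, $F<G$ means $\max F<\min G$. A matrix $B$ with rational entries is image partition regular (IPR) if, whenever $\mathbb N$ is finitely coloured, there is a vector $\vec x$ with entries in $\mathbb N$ such that all entries of $B\vec x$ are natural numbers of the same colour. For finite nonempty sets $Y_n\subseteq\mathbb Q$ ($n<\omega$): $FS(\langle Y_n\rangle_{n=0}^\infty)=\{\sum_{n\in F}x_n: F\in\mathcal P_f(\omega)\text{ and }x_n\in Y_n\text{ for each }n\in F\}$; and $MT(\langle 2,1\rangle,\langle Y_n\rangle_{n=0}^\infty)=\{2\sum_{t\in F_0}x_t+\sum_{t\in F_1}x_t: F_0,F_1\in\mathcal P_f(\omega),\ F_0<F_1,\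 x_t\in Y_t\text{ for each }t\in F_0\cup F_1\}$. For $b\in\mathbb N$, $b+X=\{b+x:x\in X\}$. $\beta\mathbb N$ is the Stone–Čech compactification of the discrete space $\mathbb N$, viewed as the set of ultrafilters on $\mathbb N$, with addition given by: $A\in p+q$ if and only if $\{x\in\mathbb N:-x+A\in q\}\in p$, where $-x+A=\{y\in\mathbb N:x+y\in A\}$. This is a compact Hausdorff right topological semigroup, having a smallest two-sided ideal $K(\beta\mathbb N)$; a minimal idempotent is an idempotent $p=p+p$ belonging to $K(\beta\mathbb N)$. -}

module Defs where

open import Algebra.Bundles using (Semigroup)
open import Algebra.Definitions using (_IdempotentOn_)
open import Data.Fin.Base using (Fin)
open import Data.Integer.Base using (+_)
open import Data.List.Base using (List; foldr; map)
open import Data.List.Membership.Propositional using () renaming (_∈_ to _∈ˡ_)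
open import Data.List.NonEmpty.Base using (List⁺; toList)
open import Data.List.Relation.Unary.Unique.Propositional using (Unique)
open import Data.Nat.Base as ℕ using (ℕ; NonZero)
import Data.Nat.Properties as ℕ
open import Data.Product.Base using (Σ-syntax; ∃-syntax; _×_; _,_; proj₁; proj₂)
open import Data.Rational.Base as ℚ using (ℚ; 0ℚ)
open import Data.Sum.Base using (_⊎_; inj₁; inj₂)
open import Data.Vec.Base as Vec using (Vec; lookup; zipWith)
open import Function.Bundles using (_⇔_; mk⇔; Equivalence)
open import Level using (Level; 0ℓ; suc; _⊔_)
open import Relation.Binary.PropositionalEquality
  using (_≡_; refl; sym; subst)
open import Relation.Nullary.Negation using (contradiction)
open import Relation.Unary using (Pred; _∈_; _∉_; _⊆_; _∩_; _∪_; ∁; ∅; U)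

-- ℕ is {0,1,2,…} (written ω in the mathematics); ℕ⁺ is {1,2,3,…}.
-- The proof of positivity is irrelevant, so elements of ℕ⁺ are equal as soon
-- as their values are.

record ℕ⁺ : Set where
  constructor mkℕ⁺
  field
    value      : ℕ
    .{{pos}}   : NonZero value

open ℕ⁺ public using (value)

infixl 6 _+⁺_

_+⁺_ : ℕ⁺ → ℕ⁺ → ℕ⁺
mkℕ⁺ (ℕ.suc m) +⁺ mkℕ⁺ n = mkℕ⁺ (ℕ.suc m ℕ.+ n)

value-injective : ∀ {m n : ℕ⁺} → value m ≡ value n → m ≡ n
value-injective refl = refl

value-+⁺ : ∀ m n → value (m +⁺ n) ≡ value m ℕ.+ value n
value-+⁺ (mkℕ⁺ (ℕ.suc m)) (mkℕ⁺ n) = refl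

+⁺-assoc : ∀ l m n → (l +⁺ m) +⁺ n ≡ l +⁺ (m +⁺ n)
+⁺-assoc (mkℕ⁺ (ℕ.suc l)) (mkℕ⁺ (ℕ.suc m)) (mkℕ⁺ n) =
  value-injective (ℕ.+-assoc (ℕ.suc l) (ℕ.suc m) n)

ι : ℕ⁺ → ℚ
ι n = (+ value n) ℚ./ 1

ι⟦_⟧ : Pred ℕ⁺ 0ℓ → Pred ℚ 0ℓ
ι⟦ A ⟧ q = ∃[ n ] (n ∈ A × q ≡ ι n)

-- A finite nonempty subset is given by a duplicate-free nonempty listing of
-- its elements.  The order of the listing is immaterial: such a set is only
-- used through membership and through sums over its elements, and for the
-- latter the absence of duplicates matters.

record 𝒫f (X : Set) : Set where
  field
    listing : List⁺ X
    unique  : Unique (toList listing)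

  elements : List X
  elements = toList listing

open 𝒫f public using (elements)

⟦_⟧ : ∀ {X} → 𝒫f X → Pred X 0ℓ
⟦ F ⟧ x = x ∈ˡ elements F

-- max F < min G

_≺_ : 𝒫f ℕ → 𝒫f ℕ → Set
F ≺ G = ∀ {m n} → m ∈ ⟦ F ⟧ → n ∈ ⟦ G ⟧ → m ℕ.< n

∑[_]_ : 𝒫f ℕ → (ℕ → ℚ) → ℚ
∑[ F ] x = foldr ℚ._+_ 0ℚ (map x (elements F))

-- In FS and MT₂₁ the choice of x_t ∈ Y t for t in a finite index set is given
-- by a total function x, whose values off that index set are unconstrained
-- and unused.

FS : (ℕ → Pred ℚ 0ℓ) → Pred ℚ 0ℓ
FS Y q =
  Σ[ F ∈ 𝒫f ℕ ] Σ[ x ∈ (ℕ → ℚ) ]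
    ((∀ {t} → t ∈ ⟦ F ⟧ → x t ∈ Y t) × q ≡ ∑[ F ] x)

2ℚ : ℚ
2ℚ = (+ 2) ℚ./ 1

-- MT(⟨2,1⟩, Y)

MT₂₁ : (ℕ → Pred ℚ 0ℓ) → Pred ℚ 0ℓ
MT₂₁ Y q =
  Σ[ F₀ ∈ 𝒫f ℕ ] Σ[ F₁ ∈ 𝒫f ℕ ] Σ[ x ∈ (ℕ → ℚ) ]
    (F₀ ≺ F₁ ×
     (∀ {t} → t ∈ ⟦ F₀ ⟧ ∪ ⟦ F₁ ⟧ → x t ∈ Y t) ×
     q ≡ (2ℚ ℚ.* ∑[ F₀ ] x) ℚ.+ ∑[ F₁ ] x)

infixr 6 _⊕_

_⊕_ : ℚ → Pred ℚ 0ℓ → Pred ℚ 0ℓ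
(b ⊕ X) q = ∃[ x ] (x ∈ X × q ≡ b ℚ.+ x)

-- Finite matrices have at least one row and at least one column.

record ℚMatrix : Set where
  field
    rows cols          : ℕ
    .{{rows-nonZero}}  : NonZero rows
    .{{cols-nonZero}}  : NonZero cols
    entries            : Vec (Vec ℚ cols) rows

open ℚMatrix public using (rows; cols; entries)

_·_ : ∀ {n} → Vec ℚ n → Vec ℚ n → ℚ
v · w = Vec.foldr′ ℚ._+_ 0ℚ (zipWith ℚ._*_ v w)

image : (B : ℚMatrix) → Vec ℕ⁺ (cols B) → Vec ℚ (rows B)
image B x = Vec.map (_· Vec.map ι x) (entries B)

entrySet : ∀ {n} → Vec ℚ n → Pred ℚ 0ℓ
entrySet v q = ∃[ i ] (q ≡ lookup v i)

ImagePartitionRegular : ℚMatrix → Set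
ImagePartitionRegular B =
  ∀ {r} (colour : ℕ⁺ → Fin r) →
  Σ[ x ∈ Vec ℕ⁺ (cols B) ] Σ[ c ∈ Fin r ]
    entrySet (image B x) ⊆ ι⟦ (λ n → colour n ≡ c) ⟧

-- Repetitions in an enumeration are allowed.

EnumeratesIPR : (ℕ → ℚMatrix) → Set
EnumeratesIPR B =
  (∀ n → ImagePartitionRegular (B n)) ×
  (∀ M → ImagePartitionRegular M → ∃[ n ] (B n ≡ M))

record Ultrafilter (X : Set) : Set₁ where
  field
    sets     : Pred (Pred X 0ℓ) 0ℓ
    whole    : U ∈ sets
    proper   : ∅ ∉ sets
    upward   : ∀ {A B : Pred X 0ℓ} → A ⊆ B → A ∈ sets → B ∈ sets
    meet     : ∀ {A B : Pred X 0ℓ} → A ∈ sets → B ∈ sets → A ∩ B ∈ sets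
    maximal  : ∀ (A : Pred X 0ℓ) → A ∈ sets ⊎ ∁ A ∈ sets

open Ultrafilter public

βℕ : Set₁
βℕ = Ultrafilter ℕ⁺

-- Equality of points of βℕ is having the same members.

infix 4 _≈ᵘ_

_≈ᵘ_ : βℕ → βℕ → Set₁
p ≈ᵘ q = ∀ (A : Pred ℕ⁺ 0ℓ) → (A ∈ sets p) ⇔ (A ∈ sets q)

infixr 7 -_+ˢ_

-_+ˢ_ : ℕ⁺ → Pred ℕ⁺ 0ℓ → Pred ℕ⁺ 0ℓ
(- x +ˢ A) y = x +⁺ y ∈ A

infixl 6 _+ᵘ_

_+ᵘ_ : βℕ → βℕ → βℕ
p +ᵘ q = record
  { sets    = λ A → (λ x → - x +ˢ A ∈ sets q) ∈ sets p
  ; whole   = upward p (λ _ → whole q) (whole p)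
  ; proper  = λ h → proper p (upward p (proper q) h)
  ; upward  = λ A⊆B → upward p (upward q A⊆B)
  ; meet    = λ h k → upward p (λ (a , b) → meet q a b) (meet p h k)
  ; maximal = split
  }
  where
  split : ∀ A → (λ x → - x +ˢ A ∈ sets q) ∈ sets p
              ⊎ (λ x → - x +ˢ ∁ A ∈ sets q) ∈ sets p
  split A with maximal p (λ x → - x +ˢ A ∈ sets q)
  ... | inj₁ h = inj₁ h
  ... | inj₂ h = inj₂ (upward p flip h)
    where
    flip : ∀ {x} → - x +ˢ A ∉ sets q → - x +ˢ ∁ A ∈ sets q
    flip {x} ¬a with maximal q (- x +ˢ A)
    ... | inj₁ a = contradiction a ¬a
    ... | inj₂ b = b

βℕ-semigroup : Semigroup (suc 0ℓ) (suc 0ℓ)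
βℕ-semigroup = record
  { Carrier     = βℕ
  ; _≈_         = _≈ᵘ_
  ; _∙_         = _+ᵘ_
  ; isSemigroup = record
    { isMagma = record
      { isEquivalence = record
        { refl  = λ A → mk⇔ (λ h → h) (λ h → h)
        ; sym   = λ e A → mk⇔ (from (e A)) (to (e A))
        ; trans = λ e f A → mk⇔ (λ h → to (f A) (to (e A) h))
                                (λ h → from (e A) (from (f A) h))
        }
      ; ∙-cong = λ {p} {p′} {q} {q′} e f A → mk⇔
          (λ h → to (e _) (upward p (λ {x} → to (f (- x +ˢ A))) h))
          (λ h → from (e _) (upward p′ (λ {x} → from (f (- x +ˢ A))) h))
      }
    ; assoc = λ p q r A → mk⇔
        (upward p λ {x} → upward q λ {y} → upward r λ {z} →
          subst A (+⁺-assoc x y z))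
        (upward p λ {x} → upward q λ {y} → upward r λ {z} →
          subst A (sym (+⁺-assoc x y z)))
    }
  }
  where open Equivalence

module _ {c ℓ : Level} (S : Semigroup c ℓ) where
  open Semigroup S

  record TwoSidedIdeal (i : Level) : Set (c ⊔ ℓ ⊔ suc i) where
    field
      carrier  : Pred Carrier i
      resp     : ∀ {x y} → x ≈ y → x ∈ carrier → y ∈ carrier
      nonEmpty : ∃[ x ] (x ∈ carrier)
      absorbˡ  : ∀ s {x} → x ∈ carrier → s ∙ x ∈ carrier
      absorbʳ  : ∀ s {x} → x ∈ carrier → x ∙ s ∈ carrier

  -- The smallest two-sided ideal, as the intersection of all two-sided
  -- ideals; an intersection of ideals that has an element is an ideal.

  K : (i : Level) → Pred Carrier (c ⊔ ℓ ⊔ suc i)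
  K i x = ∀ (I : TwoSidedIdeal i) → x ∈ TwoSidedIdeal.carrier I

-- Level suc 0ℓ accommodates ideals given by formulas quantifying over βℕ, such
-- as βℕ + q + βℕ; under excluded middle the choice of level is immaterial.

MinimalIdempotent : βℕ → Set₂
MinimalIdempotent p = (_IdempotentOn_ _≈ᵘ_ _+ᵘ_ p) × p ∈ K βℕ-semigroup (suc 0ℓ)

{-# OPTIONS --safe #-}

module Submission where

open import Defs
import Algebra.Bundles as Bundles
import Algebra.Properties.Semiring.Sum as SemiringSum
open import Axiom.ExcludedMiddle using (ExcludedMiddle)
open import Axiom.Extensionality.Propositional using (Extensionality; lower-extensionality)
open import Data.Bool.Base using (Bool; true; false)
open import Data.Empty using (⊥)
open import Data.Fin.Base as Fin using (Fin; zero; suc; toℕ; fromℕ<)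
import Data.Fin.Properties as Fin
open import Data.Integer.Base as ℤ using (+_)
import Data.Integer.Properties as ℤ
open import Data.List.Base as List using (List; []; _∷_)
open import Data.List.Membership.Propositional using () renaming (_∈_ to _∈ˡ_)
open import Data.List.Membership.Propositional.Properties
  using (∈-tabulate⁺; ∈-tabulate⁻; ∈-deduplicate⁺; ∈-deduplicate⁻)
open import Data.List.NonEmpty.Base using (_∷_)
open import Data.List.Relation.Binary.Permutation.Propositional using (_↭_; ↭-sym; ↭⇒↭ₛ)
open import Data.List.Relation.Binary.Permutation.Propositional.Properties
  using (∈-resp-↭) renaming (map⁺ to ↭-map⁺)
import Data.List.Relation.Binary.Permutation.Setoid.Properties as ↭ₛ
open import Data.List.Relation.Unary.All as All using (All; []; _∷_)
open import Data.List.Relation.Unary.AllPairs as AllPairs using (AllPairs; []; _∷_)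
open import Data.List.Relation.Unary.Any as Any using (Any; here; there)
import Data.List.Relation.Unary.Any.Properties as Any
open import Data.List.Relation.Unary.Linked.Properties using (Linked⇒AllPairs)
import Data.List.Relation.Unary.Unique.DecPropositional.Properties as Unique
open import Data.List.Relation.Unary.Unique.Propositional using (Unique)
open import Data.Nat.Base as ℕ using (ℕ; zero; suc; NonZero)
open import Data.Nat.Divisibility using (_∣_; divides; ∣m+n∣m⇒∣n; n∣m*n; m%n≡0⇒n∣m; n∣m⇒m%n≡0)
open import Data.Nat.DivMod using (_/_; _%_; m≡m%n+[m/n]*n; m%n<n; m/n*n≤m)
import Data.Nat.Properties as ℕ
open import Data.List.Sort ℕ.≤-decTotalOrder using (sort; sort-↭; sort-↗)
open import Data.Product.Base using (Σ; Σ-syntax; ∃; ∃-syntax; _×_; _,_; proj₁; proj₂)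
open import Data.Rational.Base as ℚ using (ℚ; 0ℚ; 1ℚ)
import Data.Rational.Properties as ℚ
open import Data.Rational.Solver using (module +-*-Solver)
import Data.Rational.Unnormalised.Base as ℚᵘ
import Data.Rational.Unnormalised.Properties as ℚᵘ
open import Data.Sum.Base using (_⊎_; inj₁; inj₂; [_,_]′)
open import Data.Vec.Base as Vec using (Vec)
import Data.Vec.Properties as Vec
open import Function.Bundles using (Equivalence)
open import Level as Level using (0ℓ; Lift; lift)
open import Relation.Binary.Definitions using (tri<; tri≈; tri>)
open import Relation.Binary.PropositionalEquality
open import Relation.Nullary using (¬_; Dec; yes; no; does; contradiction)
open import Relation.Nullary.Decidable using (map′)
open import Relation.Unary using (Pred; _∈_; _∉_; _⊆_; _∩_; _∪_; _≐_; ∁; ∅; U)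
open SemiringSum (Bundles.CommutativeRing.semiring ℚ.+-*-commutativeRing)
  using (sum; sum-cong-≗; ∑-comm; ∑-distrib-+; *-distribˡ-sum; *-distribʳ-sum; sum-replicate-zero)

-- Call q recurrent if for every x and every A ∈ q some −b + A belongs to x + q.
-- The recurrent ultrafilters form a two-sided ideal, which is nonempty because
-- every ultrafilter extending a maximal shift-invariant filter is recurrent;
-- hence p is recurrent.  So −b + A ∈ 2p + p for some b, and for A ∈ p the set
-- {n : −n + A ∈ p} is syndetic.  By the Furstenberg–Weiss recurrence argument
-- the latter yields, inside any member of p, configurations
-- z, z + g₁(w), …, z + gᵤ(w) with w in a given member of an idempotent filter
-- and additive functionals gᵢ.
--
-- Let M be image partition regular.  Colouring numbers by blocks of small
-- relative length (read periodically) gives an image of M whose entries split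
-- into clusters of nearly equal entries, distinct clusters differing by a large
-- factor.  By Farkas' lemma there is then, for each cluster, a nonnegative
-- vector ξ such that M ξ is 1 on this cluster, 0 on the smaller and
-- nonnegative on the larger ones.  Starting from the given vector and treating
-- the clusters in increasing order, the configurations above allow multiples
-- of the ξ to be added so that the rows of one more cluster land in the given
-- member C of p; thus C contains an image of M.
--
-- Finally, 2p + 2p + p = 2p + p and p + p = p allow the images Yₙ to be chosen
-- one at a time, as in the proof of Hindman's theorem.

-- Classical logic from excluded middle.

module Classical (em : ExcludedMiddle (Level.suc 0ℓ)) where

  em₀ : {P : Set} → Dec P
  em₀ {P} with em {Lift (Level.suc 0ℓ) P}
  ... | yes (lift h) = yes h
  ... | no ¬h = no λ h → ¬h (lift h)

  by-contradiction : {P : Set} → ¬ ¬ P → P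
  by-contradiction {P} ¬¬h with em₀ {P}
  ... | yes h = h
  ... | no ¬h = contradiction ¬h ¬¬h

  -- Deciding in Bool makes extensionally equal subsets equal, and moves a
  -- predicate down to the lowest universe.
  ⌊_⌋ : {X : Set} → (X → Set₁) → X → Bool
  ⌊ P ⌋ x = does (em {P x})

  ⌊⌋⁺ : ∀ {X : Set} (P : X → Set₁) {x} → P x → ⌊ P ⌋ x ≡ true
  ⌊⌋⁺ P {x} h with em {P x}
  ... | yes _ = refl
  ... | no ¬h = contradiction h ¬h

  ⌊⌋⁻ : ∀ {X : Set} (P : X → Set₁) {x} → ⌊ P ⌋ x ≡ true → P x
  ⌊⌋⁻ P {x} e with em {P x}
  ... | yes h = h
  ⌊⌋⁻ P () | no _

-- Zorn's lemma for families of subsets, by a tower construction.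

module Zorn (em : ExcludedMiddle (Level.suc 0ℓ)) (ext : Extensionality 0ℓ 0ℓ) {X : Set} where
  open Classical em

  Sub : Set
  Sub = X → Bool

  infix 4 _≼_
  _≼_ : Sub → Sub → Set
  F ≼ G = ∀ x → F x ≡ true → G x ≡ true

  ≼-antisym : ∀ {F G} → F ≼ G → G ≼ F → F ≡ G
  ≼-antisym {F} {G} F≼G G≼F = ext λ x → go x (F x) (G x) refl refl
    where
    go : ∀ x b c → F x ≡ b → G x ≡ c → F x ≡ G x
    go x true  _     p _ = trans p (sym (F≼G x p))
    go x false true  p q = trans (G≼F x q) (sym q)
    go x false false p q = trans p (sym q)

  Covered : (Sub → Set) → X → Set₁
  Covered Q x = Lift (Level.suc 0ℓ) (Σ[ F ∈ Sub ] Q F × F x ≡ true)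

  ⋃ : (Sub → Set) → Sub
  ⋃ Q = ⌊ Covered Q ⌋

  ⋃-upper : ∀ {Q F} → Q F → F ≼ ⋃ Q
  ⋃-upper {Q} q x Fx = ⌊⌋⁺ (Covered Q) (lift (_ , q , Fx))

  ⋃-least : ∀ {Q G} → (∀ F → Q F → F ≼ G) → ⋃ Q ≼ G
  ⋃-least {Q} h x e with ⌊⌋⁻ (Covered Q) e
  ... | lift (F , q , Fx) = h F q x Fx

  Chain : (Sub → Set) → Set
  Chain Q = ∀ F G → Q F → Q G → F ≼ G ⊎ G ≼ F

  module _ (P : Sub → Set₁)
           (P-⋃ : ∀ Q → ∃ Q → (∀ F → Q F → P F) → Chain Q → P (⋃ Q))
           (base : Sub) (P-base : P base) where

    Larger : Sub → Set₁
    Larger F = Σ[ G ∈ Sub ] P G × F ≼ G × ¬ (G ≼ F)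

    -- Excluded middle applied to the Σ-type `Larger F` returns a witness and so acts as a choice
    -- function.
    next : Sub → Sub
    next F with em {Larger F}
    ... | yes (G , _) = G
    ... | no _        = F

    next-upper : ∀ F → F ≼ next F
    next-upper F with em {Larger F}
    ... | yes (_ , _ , F≼G , _) = F≼G
    ... | no _                  = λ _ h → h

    next-P : ∀ {F} → P F → P (next F)
    next-P {F} PF with em {Larger F}
    ... | yes (_ , PG , _) = PG
    ... | no _             = PF

    next-maximal : ∀ {F} → next F ≼ F → ∀ G → P G → F ≼ G → G ≼ F
    next-maximal {F} h G PG F≼G with em {Larger F}
    ... | yes (_ , _ , _ , ¬h) = contradiction h ¬h
    ... | no ¬L with em₀ {G ≼ F}
    ...   | yes G≼F = G≼F
    ...   | no ¬G≼F = contradiction (G , PG , F≼G , ¬G≼F) ¬L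

    data Tower : Sub → Set₁ where
      start : Tower base
      step  : ∀ {F} → Tower F → Tower (next F)
      union : ∀ Q → ∃ Q → (∀ F → Q F → Tower F) → Tower (⋃ Q)

    base-least : ∀ {F} → Tower F → base ≼ F
    base-least start = λ _ h → h
    base-least (step {F} t) x h = next-upper F x (base-least t x h)
    base-least (union Q (F , q) ts) x h = ⋃-upper q x (base-least (ts F q) x h)

    Extreme : Sub → Set₁
    Extreme C = ∀ {F} → Tower F → F ≼ C → ¬ (C ≼ F) → next F ≼ C

    -- Induction on F. In the successor case, if F is strictly below C then extremality keeps
    -- `next F` below C; if C ≼ F as well, then F = C by antisymmetry.
    extreme-comparable : ∀ {C} → Tower C → Extreme C → ∀ {F} → Tower F → F ≼ C ⊎ next C ≼ F
    extreme-comparable tC eC start = inj₁ (base-least tC)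
    extreme-comparable {C} tC eC (step {F} tF) with extreme-comparable tC eC tF
    ... | inj₂ h = inj₂ λ x z → next-upper F x (h x z)
    ... | inj₁ F≼C with em₀ {C ≼ F}
    ...   | no ¬h = inj₁ (eC tF F≼C ¬h)
    ...   | yes C≼F = inj₂ (subst (λ G → next C ≼ next G) (≼-antisym C≼F F≼C) (λ _ h → h))
    extreme-comparable {C} tC eC (union Q _ ts)
      with em₀ {Σ[ F ∈ Sub ] Q F × next C ≼ F}
    ... | yes (F , q , h) = inj₂ λ x z → ⋃-upper q x (h x z)
    ... | no ¬h = inj₁ (⋃-least λ F q → below F q (extreme-comparable tC eC (ts F q)))
      where
      below : ∀ F → Q F → F ≼ C ⊎ next C ≼ F → F ≼ C
      below F q (inj₁ h) = h
      below F q (inj₂ h) = contradiction (F , q , h) ¬h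

    all-extreme : ∀ {C} → Tower C → Extreme C
    all-extreme start tF _ ¬h = contradiction (base-least tF) ¬h
    all-extreme (step {C} tC) {F} tF F≼ ¬h with extreme-comparable tC (all-extreme tC) tF
    ... | inj₂ h = contradiction h ¬h
    ... | inj₁ F≼C with em₀ {C ≼ F}
    ...   | no ¬C≼F = λ x z → next-upper C x (all-extreme tC tF F≼C ¬C≼F x z)
    ...   | yes C≼F = subst (λ G → next F ≼ next G) (≼-antisym F≼C C≼F) (λ _ h → h)
    all-extreme (union Q _ ts) {F} tF F≼ ¬h
      with em₀ {Σ[ C ∈ Sub ] Q C × ¬ (C ≼ F)}
    ... | no none = contradiction (⋃-least λ C q → by-contradiction λ ¬h → none (C , q , ¬h)) ¬h
    ... | yes (C , q , ¬C≼F) with extreme-comparable (ts C q) (all-extreme (ts C q)) tF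
    ...   | inj₂ h = contradiction (λ x z → h x (next-upper C x z)) ¬C≼F
    ...   | inj₁ F≼C = λ x z → ⋃-upper q x (all-extreme (ts C q) tF F≼C ¬C≼F x z)

    tower-chain : ∀ {F G} → Tower F → Tower G → F ≼ G ⊎ G ≼ F
    tower-chain {F} {G} tF tG with extreme-comparable tG (all-extreme tG) tF
    ... | inj₁ h = inj₁ h
    ... | inj₂ h = inj₂ λ x z → h x (next-upper G x z)

    tower-P : ∀ {F} → Tower F → P F
    tower-P start = P-base
    tower-P (step t) = next-P (tower-P t)
    tower-P (union Q ne ts) =
      P-⋃ Q ne (λ F q → tower-P (ts F q)) λ F G q r → tower-chain (ts F q) (ts G r)

    -- The union `top` of the whole tower belongs to the tower, hence so does `next top`, which
    -- therefore lies below `top`; so nothing satisfying `P` is strictly larger.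
    maximal-above : Σ[ M ∈ Sub ] P M × base ≼ M × (∀ G → P G → M ≼ G → G ≼ M)
    maximal-above = top , tower-P tTop , base-least tTop , next-maximal (⋃-upper (⌊⌋ᵗ (step tTop)))
      where
      Q : Sub → Set
      Q F = does (em {Tower F}) ≡ true
      ⌊⌋ᵗ : ∀ {F} → Tower F → Q F
      ⌊⌋ᵗ = ⌊⌋⁺ Tower
      top : Sub
      top = ⋃ Q
      tTop : Tower top
      tTop = union Q (base , ⌊⌋ᵗ start) λ F → ⌊⌋⁻ Tower

-- Maximal filters and ultrafilters.

record IsFilter {X Op : Set} (act : Op → X → X) (𝓕 : Pred (Pred X 0ℓ) 0ℓ) : Set₁ where
  field
    whole     : U ∈ 𝓕
    proper    : ∅ ∉ 𝓕
    upward    : ∀ {A B : Pred X 0ℓ} → A ⊆ B → A ∈ 𝓕 → B ∈ 𝓕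
    meet      : ∀ {A B : Pred X 0ℓ} → A ∈ 𝓕 → B ∈ 𝓕 → A ∩ B ∈ 𝓕
    invariant : ∀ o {A : Pred X 0ℓ} → A ∈ 𝓕 → (λ x → A (act o x)) ∈ 𝓕

module Filters (em : ExcludedMiddle (Level.suc 0ℓ)) (ext : Extensionality 0ℓ 0ℓ) where
  open Classical em
  open IsFilter

  module _ {X Op : Set} (act : Op → X → X) where
    open Zorn em ext {X → Bool}

    χ : Pred X 0ℓ → X → Bool
    χ A = ⌊ (λ x → Lift (Level.suc 0ℓ) (A x)) ⌋

    χ⁺ : ∀ (A : Pred X 0ℓ) {x} → A x → χ A x ≡ true
    χ⁺ A h = ⌊⌋⁺ (λ x → Lift (Level.suc 0ℓ) (A x)) (lift h)

    χ⁻ : ∀ (A : Pred X 0ℓ) {x} → χ A x ≡ true → A x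
    χ⁻ A e with ⌊⌋⁻ (λ x → Lift (Level.suc 0ℓ) (A x)) e
    ... | lift h = h

    -- Testing A through its characteristic function turns families of predicates into `Bool`-valued
    -- subsets of the small type `X → Bool`, to which `Zorn` applies.
    family : Sub → Pred (Pred X 0ℓ) 0ℓ
    family F A = F (χ A) ≡ true

    code : Pred (Pred X 0ℓ) 0ℓ → Sub
    code 𝓕 = ⌊ (λ S → Lift (Level.suc 0ℓ) ((λ x → S x ≡ true) ∈ 𝓕)) ⌋

    module _ {𝓕 : Pred (Pred X 0ℓ) 0ℓ} (isF : IsFilter act 𝓕) where

      private
        Coded : (X → Bool) → Set₁
        Coded S = Lift (Level.suc 0ℓ) ((λ x → S x ≡ true) ∈ 𝓕)

      code⁺ : 𝓕 ⊆ family (code 𝓕)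
      code⁺ {A} h = ⌊⌋⁺ Coded (lift (upward isF (χ⁺ A) h))

      code⁻ : family (code 𝓕) ⊆ 𝓕
      code⁻ {A} e with ⌊⌋⁻ Coded e
      ... | lift h = upward isF (χ⁻ A) h

    IsFilter-resp : {𝓕 𝓖 : Pred (Pred X 0ℓ) 0ℓ} → 𝓕 ⊆ 𝓖 → 𝓖 ⊆ 𝓕 →
                    IsFilter act 𝓕 → IsFilter act 𝓖
    IsFilter-resp f g isF = record
      { whole     = f (whole isF)
      ; proper    = λ h → proper isF (g h)
      ; upward    = λ A⊆B h → f (upward isF A⊆B (g h))
      ; meet      = λ h k → f (meet isF (g h) (g k))
      ; invariant = λ o h → f (invariant isF o (g h))
      }

    ⋃-isFilter : ∀ Q → ∃ Q → (∀ F → Q F → IsFilter act (family F)) → Chain Q →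
                 IsFilter act (family (⋃ Q))
    ⋃-isFilter Q (F₀ , q₀) isF chain = IsFilter-resp into out record
      { whole     = F₀ , q₀ , whole (isF F₀ q₀)
      ; proper    = λ (F , q , h) → proper (isF F q) h
      ; upward    = λ A⊆B (F , q , h) → F , q , upward (isF F q) A⊆B h
      ; meet      = both
      ; invariant = λ o (F , q , h) → F , q , invariant (isF F q) o h
      }
      where
      member : Pred (Pred X 0ℓ) 0ℓ
      member A = Σ[ F ∈ Sub ] Q F × A ∈ family F
      into : member ⊆ family (⋃ Q)
      into {A} (F , q , h) = ⋃-upper q (χ A) h
      out : family (⋃ Q) ⊆ member
      out e with ⌊⌋⁻ (Covered Q) e
      ... | lift h = h
      both : ∀ {A B} → member A → member B → member (A ∩ B)
      both {A} {B} (F , q , h) (G , r , k) with chain F G q r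
      ... | inj₁ F≼G = G , r , meet (isF G r) (F≼G (χ A) h) k
      ... | inj₂ G≼F = F , q , meet (isF F q) h (G≼F (χ B) k)

    -- One application of Zorn's lemma serves both shift-invariant filters, with `Op` = `ℕ⁺`, and
    -- ordinary filters, with `Op` empty.
    maximal-filter : ∀ {𝓕} → IsFilter act 𝓕 →
      Σ[ 𝓜 ∈ Pred (Pred X 0ℓ) 0ℓ ] IsFilter act 𝓜 × 𝓕 ⊆ 𝓜 ×
        (∀ {𝓖 : Pred (Pred X 0ℓ) 0ℓ} → IsFilter act 𝓖 → 𝓜 ⊆ 𝓖 → 𝓖 ⊆ 𝓜)
    maximal-filter {𝓕} isF
      with maximal-above (λ F → IsFilter act (family F)) ⋃-isFilter (code 𝓕)
             (IsFilter-resp (code⁺ isF) (code⁻ isF) isF)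
    ... | M , isM , 𝓕≼M , max = family M , isM , (λ {A} h → 𝓕≼M (χ A) (code⁺ isF h)) , maxM
      where
      maxM : ∀ {𝓖 : Pred (Pred X 0ℓ) 0ℓ} → IsFilter act 𝓖 → family M ⊆ 𝓖 → 𝓖 ⊆ family M
      maxM {𝓖} isG M⊆𝓖 {A} h =
        max (code 𝓖) (IsFilter-resp (code⁺ isG) (code⁻ isG) isG)
          (λ S MS → code⁺S S (M⊆𝓖 (subst (λ T → M T ≡ true) (χ-true S) MS)))
          (χ A) (code⁺ isG h)
        where
        χ-true : ∀ S → S ≡ χ (λ x → S x ≡ true)
        χ-true S = Zorn.≼-antisym em ext (λ x → χ⁺ (λ x → S x ≡ true)) λ x → χ⁻ (λ x → S x ≡ true)
        code⁺S : ∀ S → (λ x → S x ≡ true) ∈ 𝓖 → code 𝓖 S ≡ true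
        code⁺S S h = ⌊⌋⁺ (λ T → Lift (Level.suc 0ℓ) ((λ x → T x ≡ true) ∈ 𝓖)) {S} (lift h)

  module _ {X : Set} where

    -- A maximal filter decides every A: if `∁ A` is not a member, then the filter generated
    -- together with A is proper, so by maximality A was already a member.
    ultrafilter-above : ∀ {𝓕 : Pred (Pred X 0ℓ) 0ℓ} → IsFilter {Op = ⊥} (λ _ x → x) 𝓕 →
                        Σ[ q ∈ Ultrafilter X ] 𝓕 ⊆ sets q
    ultrafilter-above isF with maximal-filter (λ _ x → x) isF
    ... | 𝓜 , isM , 𝓕⊆𝓜 , max = record
      { sets    = 𝓜
      ; whole   = whole isM
      ; proper  = proper isM
      ; upward  = upward isM
      ; meet    = meet isM
      ; maximal = decide
      } , 𝓕⊆𝓜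
      where
      decide : ∀ A → A ∈ 𝓜 ⊎ ∁ A ∈ 𝓜
      decide A with em₀ {∁ A ∈ 𝓜}
      ... | yes h = inj₂ h
      ... | no ¬h = inj₁ (max adjoined (λ {B} h → upward isM (λ b _ → b) h) (upward isM (λ _ a → a) (whole isM)))
        where
        adjoined : IsFilter (λ _ x → x) (λ E → (λ x → x ∈ A → x ∈ E) ∈ 𝓜)
        adjoined = record
          { whole     = upward isM (λ _ _ → _) (whole isM)
          ; proper    = ¬h
          ; upward    = λ B⊆C → upward isM (λ f a → B⊆C (f a))
          ; meet      = λ h k → upward isM (λ (f , g) a → f a , g a) (meet isM h k)
          ; invariant = λ ()
          }

∁-member : ∀ {X} (q : Ultrafilter X) {A} → A ∉ sets q → ∁ A ∈ sets q
∁-member q {A} A∉q with maximal q A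
... | inj₁ h = contradiction h A∉q
... | inj₂ h = h

member-disjoint : ∀ {X} (q : Ultrafilter X) {A} → A ∈ sets q → ∁ A ∉ sets q
member-disjoint q h k = proper q (upward q (λ (a , ¬a) → ¬a a) (meet q h k))

-- Recurrent ultrafilters and syndetic return sets.

shift-shift : ∀ (A : Pred ℕ⁺ 0ℓ) m n → - m +ˢ - n +ˢ A ≐ - (n +⁺ m) +ˢ A
shift-shift A m n = (λ {x} → subst A (sym (+⁺-assoc n m x))) , λ {x} → subst A (+⁺-assoc n m x)

Recurrent : Pred βℕ (Level.suc 0ℓ)
Recurrent q = ∀ (x : βℕ) (A : Pred ℕ⁺ 0ℓ) → A ∈ sets q → Σ[ b ∈ ℕ⁺ ] (- b +ˢ A ∈ sets (x +ᵘ q))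

module Recurrence (em : ExcludedMiddle (Level.suc 0ℓ)) (ext : Extensionality 0ℓ 0ℓ) where
  open Classical em
  open Filters em ext

  inhabited : ∀ {X} (q : Ultrafilter X) {A : Pred X 0ℓ} → A ∈ sets q → Σ[ x ∈ X ] x ∈ A
  inhabited q {A} h = by-contradiction λ none → proper q (upward q (λ {x} a → none (x , a)) h)

  module _ {𝓜 : Pred (Pred ℕ⁺ 0ℓ) 0ℓ} (isM : IsFilter _+⁺_ 𝓜)
           (max : ∀ {𝓖 : Pred (Pred ℕ⁺ 0ℓ) 0ℓ} → IsFilter _+⁺_ 𝓖 → 𝓜 ⊆ 𝓖 → 𝓖 ⊆ 𝓜) where

    invariants : βℕ → Pred (Pred ℕ⁺ 0ℓ) 0ℓ
    invariants q A = ∀ n → - n +ˢ A ∈ sets q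

    invariants-isFilter : ∀ q → IsFilter _+⁺_ (invariants q)
    invariants-isFilter q = record
      { whole     = λ _ → whole q
      ; proper    = λ h → proper q (h (mkℕ⁺ 1))
      ; upward    = λ A⊆B h n → upward q A⊆B (h n)
      ; meet      = λ h k n → meet q (h n) (k n)
      ; invariant = λ o {A} h n → upward q (proj₂ (shift-shift A n o)) (h (o +⁺ n))
      }

    -- If no translate of A belongs to x + l, then all translates of `∁ A` do. The sets all of whose
    -- translates belong to x + l form a shift-invariant filter containing 𝓜, so by maximality `∁ A`
    -- ∈ 𝓜 ⊆ l, against A ∈ l.
    recurrent-above-maximal : ∀ l → 𝓜 ⊆ sets l → Recurrent l
    recurrent-above-maximal l 𝓜⊆l x A A∈l = by-contradiction λ none →
      member-disjoint l A∈l (𝓜⊆l (max (invariants-isFilter (x +ᵘ l)) 𝓜⊆xl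
        λ n → ∁-member (x +ᵘ l) {λ y → A (n +⁺ y)} λ h → none (n , h)))
      where
      𝓜⊆xl : 𝓜 ⊆ invariants (x +ᵘ l)
      𝓜⊆xl h n = upward x (λ {y} _ → 𝓜⊆l (IsFilter.invariant isM y (IsFilter.invariant isM n h))) (whole x)

  recurrent-exists : Σ[ l ∈ βℕ ] Recurrent l
  recurrent-exists with maximal-filter _+⁺_ {λ A → ∀ x → x ∈ A} record
    { whole     = _
    ; proper    = λ h → h (mkℕ⁺ 1)
    ; upward    = λ A⊆B h x → A⊆B (h x)
    ; meet      = λ h k x → h x , k x
    ; invariant = λ o h x → h (o +⁺ x)
    }
  ... | 𝓜 , isM , _ , max with ultrafilter-above {𝓕 = 𝓜} record
    { whole     = IsFilter.whole isM
    ; proper    = IsFilter.proper isM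
    ; upward    = IsFilter.upward isM
    ; meet      = IsFilter.meet isM
    ; invariant = λ ()
    }
  ...   | l , 𝓜⊆l = l , recurrent-above-maximal isM max l 𝓜⊆l

  -- For s + q, some -n + A belongs to q, and recurrence of q is used with x + s in place of x. For
  -- q + s, recurrence of q is used for the set of v with -v + A ∈ s.
  recurrent-ideal : TwoSidedIdeal βℕ-semigroup (Level.suc 0ℓ)
  recurrent-ideal = record
    { carrier  = Recurrent
    ; resp     = λ {q} {r} q≈r rec x A A∈r →
        let b , h = rec x A (Equivalence.from (q≈r A) A∈r)
        in b , upward x (λ {y} → Equivalence.to (q≈r (- y +ˢ - b +ˢ A))) h
    ; nonEmpty = recurrent-exists
    ; absorbˡ  = left
    ; absorbʳ  = right
    }
    where
    left : ∀ s {q} → Recurrent q → Recurrent (s +ᵘ q)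
    left s {q} rec x A A∈sq with inhabited s A∈sq
    ... | n , h with rec (x +ᵘ s) (- n +ˢ A) h
    ...   | b , k = n +⁺ b , upward x (λ {y} → upward s λ {z} → upward q λ {w} →
              subst A (trans (sym (+⁺-assoc n b _)) (cong ((n +⁺ b) +⁺_) (+⁺-assoc y z w)))) k

    right : ∀ s {q} → Recurrent q → Recurrent (q +ᵘ s)
    right s {q} rec x A A∈qs with rec x (λ v → - v +ˢ A ∈ sets s) A∈qs
    ... | b , h = b , upward x (λ {y} → upward q λ {z} → upward s λ {w} →
              subst A (trans (+⁺-assoc b (y +⁺ z) w) (cong (b +⁺_) (+⁺-assoc y z w)))) h

  minimal⇒recurrent : ∀ {p} → MinimalIdempotent p → Recurrent p
  minimal⇒recurrent (_ , p∈K) = p∈K recurrent-ideal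

  -- If no finite list of translates of {n : -n + A ∈ p} covered `ℕ⁺`, the complements of finite
  -- unions of them would generate a proper filter. An ultrafilter x above it contradicts -b + A ∈ x
  -- + p, as the list consisting of b alone shows.
  recurrent⇒syndetic : ∀ {p} → Recurrent p → ∀ A → A ∈ sets p →
    Σ[ ts ∈ List ℕ⁺ ] (∀ n → Any (λ t → - (t +⁺ n) +ˢ A ∈ sets p) ts)
  recurrent⇒syndetic {p} rec A A∈p = by-contradiction λ none →
    let x , 𝓔⊆x = ultrafilter-above (isE none)
        b , h   = rec x A A∈p
    in member-disjoint x h (𝓔⊆x {λ n → ¬ (- n +ˢ - b +ˢ A ∈ sets p)}
         ((b ∷ []) , λ n miss k → miss (here (upward p (proj₁ (shift-shift A n b)) k))))
    where
    Misses : List ℕ⁺ → Pred ℕ⁺ 0ℓ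
    Misses ts n = ¬ Any (λ t → - (t +⁺ n) +ˢ A ∈ sets p) ts
    𝓔 : Pred (Pred ℕ⁺ 0ℓ) 0ℓ
    𝓔 E = Σ[ ts ∈ List ℕ⁺ ] (∀ n → n ∈ Misses ts → n ∈ E)
    isE : ¬ (Σ[ ts ∈ List ℕ⁺ ] (∀ n → Any (λ t → - (t +⁺ n) +ˢ A ∈ sets p) ts)) →
          IsFilter {Op = ⊥} (λ _ x → x) 𝓔
    isE none = record
      { whole     = [] , _
      ; proper    = λ (ts , f) → none (ts , λ n → by-contradiction (f n))
      ; upward    = λ A⊆B (ts , f) → ts , λ n m → A⊆B (f n m)
      ; meet      = λ (ts , f) (us , g) → ts List.++ us , λ n m →
          f n (λ a → m (Any.++⁺ˡ a)) , g n (λ a → m (Any.++⁺ʳ ts a))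
      ; invariant = λ ()
      }

-- The embedding of the natural numbers into ℚ.

opaque
  fromℕ : ℕ → ℚ
  fromℕ n = (+ n) ℚ./ 1

  toℚᵘ-fromℕ : ∀ n → ℚ.toℚᵘ (fromℕ n) ℚᵘ.≃ ℚᵘ.mkℚᵘ (+ n) 0
  toℚᵘ-fromℕ n = ℚ.toℚᵘ-fromℚᵘ (ℚᵘ.mkℚᵘ (+ n) 0)

  fromℕ-+ : ∀ m n → fromℕ (m ℕ.+ n) ≡ fromℕ m ℚ.+ fromℕ n
  fromℕ-+ m n = ℚ.toℚᵘ-injective (begin
    ℚ.toℚᵘ (fromℕ (m ℕ.+ n))                      ≈⟨ toℚᵘ-fromℕ (m ℕ.+ n) ⟩
    ℚᵘ.mkℚᵘ (+ (m ℕ.+ n)) 0                       ≈⟨ ℚᵘ.*≡* (cong (ℤ._* + 1) (sym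
      (cong₂ ℤ._+_ (ℤ.*-identityʳ (+ m)) (ℤ.*-identityʳ (+ n))))) ⟩
    ℚᵘ.mkℚᵘ (+ m) 0 ℚᵘ.+ ℚᵘ.mkℚᵘ (+ n) 0          ≈⟨ ℚᵘ.+-cong (toℚᵘ-fromℕ m) (toℚᵘ-fromℕ n) ⟨
    ℚ.toℚᵘ (fromℕ m) ℚᵘ.+ ℚ.toℚᵘ (fromℕ n)        ≈⟨ ℚ.toℚᵘ-homo-+ (fromℕ m) (fromℕ n) ⟨
    ℚ.toℚᵘ (fromℕ m ℚ.+ fromℕ n)                  ∎)
    where open ℚᵘ.≃-Reasoning

  fromℕ-* : ∀ m n → fromℕ (m ℕ.* n) ≡ fromℕ m ℚ.* fromℕ n
  fromℕ-* m n = ℚ.toℚᵘ-injective (begin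
    ℚ.toℚᵘ (fromℕ (m ℕ.* n))                      ≈⟨ toℚᵘ-fromℕ (m ℕ.* n) ⟩
    ℚᵘ.mkℚᵘ (+ (m ℕ.* n)) 0                       ≈⟨ ℚᵘ.*≡* (cong (ℤ._* + 1) (ℤ.pos-* m n)) ⟩
    ℚᵘ.mkℚᵘ (+ m) 0 ℚᵘ.* ℚᵘ.mkℚᵘ (+ n) 0          ≈⟨ ℚᵘ.*-cong (toℚᵘ-fromℕ m) (toℚᵘ-fromℕ n) ⟨
    ℚ.toℚᵘ (fromℕ m) ℚᵘ.* ℚ.toℚᵘ (fromℕ n)        ≈⟨ ℚ.toℚᵘ-homo-* (fromℕ m) (fromℕ n) ⟨
    ℚ.toℚᵘ (fromℕ m ℚ.* fromℕ n)                  ∎)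
    where open ℚᵘ.≃-Reasoning

  fromℕ-mono-≤ : ∀ {m n} → m ℕ.≤ n → fromℕ m ℚ.≤ fromℕ n
  fromℕ-mono-≤ {m} {n} m≤n = ℚ.toℚᵘ-cancel-≤ (begin
    ℚ.toℚᵘ (fromℕ m)  ≃⟨ toℚᵘ-fromℕ m ⟩
    ℚᵘ.mkℚᵘ (+ m) 0   ≤⟨ ℚᵘ.*≤* (ℤ.*-monoʳ-≤-nonNeg (+ 1) (ℤ.+≤+ m≤n)) ⟩
    ℚᵘ.mkℚᵘ (+ n) 0   ≃⟨ toℚᵘ-fromℕ n ⟨
    ℚ.toℚᵘ (fromℕ n)  ∎)
    where open ℚᵘ.≤-Reasoning

  fromℕ-injective : ∀ {m n} → fromℕ m ≡ fromℕ n → m ≡ n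
  fromℕ-injective {m} {n} e with ℚᵘ.≃-trans (ℚᵘ.≃-sym (toℚᵘ-fromℕ m)) (ℚᵘ.≃-trans (ℚ.toℚᵘ-cong e) (toℚᵘ-fromℕ n))
  ... | ℚᵘ.*≡* h = ℤ.+-injective (trans (sym (ℤ.*-identityʳ (+ m))) (trans h (ℤ.*-identityʳ (+ n))))

  fromℕ-0 : fromℕ 0 ≡ 0ℚ
  fromℕ-0 = refl

  fromℕ-1 : fromℕ 1 ≡ 1ℚ
  fromℕ-1 = refl

  -- An opaque copy of ι, so that rational arithmetic on its values stays symbolic.
  ν : ℕ⁺ → ℚ
  ν n = fromℕ (value n)

  ν≡fromℕ : ∀ n → ν n ≡ fromℕ (value n)
  ν≡fromℕ n = refl

  ι≡ν : ∀ n → ι n ≡ ν n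
  ι≡ν n = refl

  ν-+ : ∀ m n → ν (m +⁺ n) ≡ ν m ℚ.+ ν n
  ν-+ m n = trans (cong fromℕ (value-+⁺ m n)) (fromℕ-+ (value m) (value n))

  ν-injective : ∀ {m n} → ν m ≡ ν n → m ≡ n
  ν-injective e = value-injective (fromℕ-injective e)

-- Members of ultrafilters, idempotent filters and integer shifts.

meet-all : ∀ {X} (q : Ultrafilter X) {u} {A : Fin u → Pred X 0ℓ} →
           (∀ i → A i ∈ sets q) → (λ x → ∀ i → x ∈ A i) ∈ sets q
meet-all q {zero} h = upward q (λ _ ()) (whole q)
meet-all q {suc u} h =
  upward q (λ (a , as) → λ { zero → a ; (suc i) → as i }) (meet q (h zero) (meet-all q (λ i → h (suc i))))

some-class : ∀ {X} (q : Ultrafilter X) {r} (P : X → Fin r → Set) {A : Pred X 0ℓ} →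
             A ∈ sets q → (∀ {x} → x ∈ A → ∃ (P x)) → Σ[ c ∈ Fin r ] A ∩ (λ x → P x c) ∈ sets q
some-class q {zero} P h cover = contradiction (upward q (λ a → absurd (cover a)) h) (proper q)
  where
  absurd : ∀ {x} → ∃ (P x) → ⊥
  absurd (() , _)
some-class q {suc r} P {A} h cover with maximal q (λ x → P x zero)
... | inj₁ k = zero , meet q h k
... | inj₂ k with some-class q (λ x c → P x (suc c)) (meet q h k) (λ (a , ¬z) → later ¬z (cover a))
  where
  later : ∀ {x} → ¬ P x zero → ∃ (P x) → ∃ (λ c → P x (suc c))
  later ¬z (zero , z)  = contradiction z ¬z
  later ¬z (suc c , z) = c , z
...   | c , l = suc c , upward q (λ ((a , _) , z) → a , z) l

-- The clause `idempotent` expresses 𝓠 ⊆ 𝓠 + 𝓠. The set of x for which -x + D ∈ 𝓠 is replaced by a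
-- smaller witness E, because membership in 𝓠 lives one universe too high to define a `Pred X 0ℓ`.
record IsIdempotentFilter {X : Set} (_⊞_ : X → X → X) (𝓠 : Pred (Pred X 0ℓ) (Level.suc 0ℓ)) : Set₁ where
  field
    inhabited  : ∀ {D} → D ∈ 𝓠 → Σ[ x ∈ X ] x ∈ D
    upward     : ∀ {D E : Pred X 0ℓ} → D ⊆ E → D ∈ 𝓠 → E ∈ 𝓠
    meet       : ∀ {D E : Pred X 0ℓ} → D ∈ 𝓠 → E ∈ 𝓠 → D ∩ E ∈ 𝓠
    idempotent : ∀ {D} → D ∈ 𝓠 → Σ[ E ∈ Pred X 0ℓ ] E ∈ 𝓠 × (∀ {x} → x ∈ E → (λ y → D (x ⊞ y)) ∈ 𝓠)

-- The translate of C by −k, where k need not be positive.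
Shift : ℚ → Pred ℕ⁺ 0ℓ → Pred ℕ⁺ 0ℓ
Shift k C z = Σ[ n ∈ ℕ⁺ ] n ∈ C × ν n ≡ ν z ℚ.+ k

-- An integer presented as a difference of positive integers, so that a shift by it can be carried
-- out inside `ℕ⁺`.
Integral : Pred ℚ 0ℓ
Integral k = Σ[ a ∈ ℕ⁺ ] Σ[ c ∈ ℕ⁺ ] k ℚ.+ ν c ≡ ν a

Integral-− : ∀ k l → Integral k → Integral l → Integral (k ℚ.- l)
Integral-− k l (a , c , e) (a′ , c′ , e′) = a +⁺ c′ , c +⁺ a′ , (begin
  (k ℚ.- l) ℚ.+ ν (c +⁺ a′)             ≡⟨ cong ((k ℚ.- l) ℚ.+_) (ν-+ c a′) ⟩
  (k ℚ.- l) ℚ.+ (ν c ℚ.+ ν a′)          ≡⟨ cong (λ t → (k ℚ.- l) ℚ.+ (ν c ℚ.+ t)) e′ ⟨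
  (k ℚ.- l) ℚ.+ (ν c ℚ.+ (l ℚ.+ ν c′))  ≡⟨ solve 4 (λ k l c c′ → (k :- l) :+ (c :+ (l :+ c′)) := (k :+ c) :+ c′)
                                             refl k l (ν c) (ν c′) ⟩
  (k ℚ.+ ν c) ℚ.+ ν c′                  ≡⟨ cong (ℚ._+ ν c′) e ⟩
  ν a ℚ.+ ν c′                          ≡⟨ ν-+ a c′ ⟨
  ν (a +⁺ c′)                           ∎)
  where
  open ≡-Reasoning
  open +-*-Solver

value>0 : ∀ n → 0 ℕ.< value n
value>0 (mkℕ⁺ n {{pos}}) = ℕ.>-nonZero⁻¹ n {{pos}}

-- Furstenberg-Weiss recurrence along an idempotent filter.

module VanDerWaerden (em : ExcludedMiddle (Level.suc 0ℓ)) (ext : Extensionality 0ℓ 0ℓ)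
                     (p : βℕ) (p-idem : p +ᵘ p ≈ᵘ p) (p-rec : Recurrent p) where
  open Classical em
  open Recurrence em ext

  p-fold : ∀ {A} → A ∈ sets (p +ᵘ p) → A ∈ sets p
  p-fold {A} = Equivalence.to (p-idem A)

  p-unfold : ∀ {A} → A ∈ sets p → A ∈ sets (p +ᵘ p)
  p-unfold {A} = Equivalence.from (p-idem A)

  -- As p = p + p, induction applies: x + y exceeds N + 1 as soon as y exceeds N.
  tail-member : ∀ N → (λ m → N ℕ.< value m) ∈ sets p
  tail-member zero = upward p (λ {m} _ → value>0 m) (whole p)
  tail-member (suc N) = p-fold (upward p (λ {x} _ → upward p (λ {y} N<y →
      subst (suc (suc N) ℕ.≤_) (sym (value-+⁺ x y)) (ℕ.+-mono-≤ (value>0 x) N<y))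
    (tail-member N)) (whole p))

  ν-∸ : ∀ m a → value a ℕ.< value m → Σ[ m′ ∈ ℕ⁺ ] ν m ≡ ν m′ ℚ.+ ν a
  ν-∸ m a a<m = m′ , trans (cong ν (value-injective (sym (trans (value-+⁺ m′ a) (ℕ.m∸n+n≡m (ℕ.<⇒≤ a<m))))))
                           (ν-+ m′ a)
    where
    m′ : ℕ⁺
    m′ = mkℕ⁺ (value m ℕ.∸ value a) {{ℕ.>-nonZero (ℕ.m<n⇒0<n∸m a<m)}}

  translates-member : ∀ a → (λ m → Σ[ m′ ∈ ℕ⁺ ] ν m ≡ ν m′ ℚ.+ ν a) ∈ sets p
  translates-member a = upward p (λ {m} → ν-∸ m a) (tail-member (value a))

  -- A form of piecewise syndeticity, relative to the right ideal p + βℕ. Unlike membership in p it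
  -- survives integer shifts, by `large-shift`.
  Large : Pred ℕ⁺ 0ℓ → Set₁
  Large R = Σ[ b ∈ ℕ⁺ ] Σ[ s ∈ βℕ ] - b +ˢ R ∈ sets (p +ᵘ s)

  large-upward : ∀ R S → R ⊆ S → Large R → Large S
  large-upward R S R⊆S (b , s , h) = b , s , upward (p +ᵘ s) {λ x → R (b +⁺ x)} {λ x → S (b +⁺ x)} R⊆S h

  large-inhabited : ∀ R → Large R → Σ[ n ∈ ℕ⁺ ] n ∈ R
  large-inhabited R (b , s , h) with inhabited (p +ᵘ s) {λ x → R (b +⁺ x)} h
  ... | n , r = b +⁺ n , r

  opaque
    large-class : ∀ {r} (P : ℕ⁺ → Fin r → Set) → (∀ n → ∃ (P n)) → ∀ R → Large R →
                  Σ[ c ∈ Fin r ] Large (R ∩ (λ n → P n c))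
    large-class P cover R (b , s , h) with some-class (p +ᵘ s) (λ x → P (b +⁺ x)) {λ x → R (b +⁺ x)} h (λ {x} _ → cover (b +⁺ x))
    ... | c , k = c , b , s , k

  opaque
    -- Let k = a - c. Writing p as p + p exposes a summand m, which may be taken larger than a.
    -- Replacing m by m′ + c with m′ = m - a moves the base point by -k.
    large-shift : ∀ k → Integral k → ∀ R → Large R → Large (Shift k R)
    large-shift k (a , c , k+c≡a) R (b , s , h)
      with inhabited p (meet p (p-unfold {λ m → - m +ˢ - b +ˢ R ∈ sets s} h) (translates-member a))
    ... | m , l , m′ , m≡ = (b +⁺ m′) +⁺ c , s , upward p (λ {x} → upward s λ {v} r →
        b +⁺ ((m +⁺ x) +⁺ v) , r , eq x v) l
      where
      open ≡-Reasoning
      open +-*-Solver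
      eq : ∀ x v → ν (b +⁺ ((m +⁺ x) +⁺ v)) ≡ ν (((b +⁺ m′) +⁺ c) +⁺ (x +⁺ v)) ℚ.+ k
      eq x v = begin
        ν (b +⁺ ((m +⁺ x) +⁺ v))
          ≡⟨ trans (ν-+ b ((m +⁺ x) +⁺ v)) (cong (ν b ℚ.+_) (trans (ν-+ (m +⁺ x) v) (cong (ℚ._+ ν v) (ν-+ m x)))) ⟩
        ν b ℚ.+ ((ν m ℚ.+ ν x) ℚ.+ ν v)
          ≡⟨ cong (λ t → ν b ℚ.+ ((t ℚ.+ ν x) ℚ.+ ν v)) (trans m≡ (cong (ν m′ ℚ.+_) (sym k+c≡a))) ⟩
        ν b ℚ.+ (((ν m′ ℚ.+ (k ℚ.+ ν c)) ℚ.+ ν x) ℚ.+ ν v)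
          ≡⟨ solve 6 (λ b m k c x v → b :+ (((m :+ (k :+ c)) :+ x) :+ v) := (((b :+ m) :+ c) :+ (x :+ v)) :+ k)
               refl (ν b) (ν m′) k (ν c) (ν x) (ν v) ⟩
        (((ν b ℚ.+ ν m′) ℚ.+ ν c) ℚ.+ (ν x ℚ.+ ν v)) ℚ.+ k
          ≡⟨ cong (ℚ._+ k) (trans (ν-+ ((b +⁺ m′) +⁺ c) (x +⁺ v)) (cong₂ ℚ._+_ (trans (ν-+ (b +⁺ m′) c) (cong (ℚ._+ ν c) (ν-+ b m′))) (ν-+ x v))) ⟨
        ν (((b +⁺ m′) +⁺ c) +⁺ (x +⁺ v)) ℚ.+ k ∎

  module _ {X : Set} {_⊞_ : X → X → X} {𝓠 : Pred (Pred X 0ℓ) (Level.suc 0ℓ)}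
           (isQ : IsIdempotentFilter _⊞_ 𝓠) where

    private module Q = IsIdempotentFilter isQ

    Additive : (X → ℚ) → Set
    Additive g = ∀ x y → g (x ⊞ y) ≡ g x ℚ.+ g y

    Pattern : ∀ {u} → (Fin u → X → ℚ) → Pred ℕ⁺ 0ℓ → X → Pred ℕ⁺ 0ℓ
    Pattern g C w z = ∀ i → z ∈ Shift (g i w) C

    -- The statement proved by induction on u. It ranges over all large C because the induction step
    -- applies it to the sets arising in `Focusing`, which need not belong to p.
    HasPatterns : ∀ {u} → (Fin u → X → ℚ) → Set₁
    HasPatterns g = ∀ {C D} → Large C → D ∈ 𝓠 → Σ[ w ∈ X ] w ∈ D × Large (Pattern g C w)

    -- One step of the Furstenberg–Weiss argument passes from a large set S of
    -- a single colour to a large set of a single colour all of whose elements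
    -- are moved into S by the functionals h evaluated at some w ∈ D.
    module Focusing {u} (h : Fin u → X → ℚ) (h-add : ∀ i → Additive (h i)) (patterns : HasPatterns h)
                    {r} (Colour : ℕ⁺ → Fin r → Set) (coloured : ∀ n → ∃ (Colour n)) where

      record State : Set₁ where
        field
          {S}    : Pred ℕ⁺ 0ℓ
          large  : Large S
          colour : Fin r
          mono   : ∀ {n} → n ∈ S → Colour n colour
          {D}    : Pred X 0ℓ
          D∈     : D ∈ 𝓠
      open State

      opaque
        move : (s : State) → Σ[ w ∈ X ] (w ∈ D s × (λ y → D s (w ⊞ y)) ∈ 𝓠) × Large (Pattern h (S s) w)
        move s with Q.idempotent (D∈ s)
        ... | E , E∈ , E-shift with patterns (large s) (Q.meet (D∈ s) E∈)
        ...   | w , (w∈D , w∈E) , l = w , (w∈D , E-shift w∈E) , l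

      pick : State → X
      pick s = proj₁ (move s)

      next : State → State
      next s with large-class Colour coloured (Pattern h (S s) (pick s)) (proj₂ (proj₂ (move s)))
      ... | c , l = record
        { S = Pattern h (S s) (pick s) ∩ (λ n → Colour n c) ; large = l ; colour = c ; mono = λ (_ , k) → k ; D∈ = Q.meet (D∈ s) (proj₂ (proj₁ (proj₂ (move s)))) }

      run : ℕ → State → State
      run zero s    = s
      run (suc k) s = run k (next s)

      run-+ : ∀ k l s → run (k ℕ.+ l) s ≡ run l (run k s)
      run-+ zero l s    = refl
      run-+ (suc k) l s = run-+ k l (next s)

      D-next : ∀ s → D (next s) ⊆ D s
      D-next s = proj₁

      D-pick : ∀ s {x} → x ∈ D (next s) → D s (pick s ⊞ x)
      D-pick s = proj₂

      pick∈D : ∀ s → pick s ∈ D s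
      pick∈D s = proj₁ (proj₁ (proj₂ (move s)))

      S-next : ∀ s → S (next s) ⊆ Pattern h (S s) (pick s)
      S-next s (a , _) = a

      opaque
        -- Successive moves compose into one move by the ⊞-sum of the picks, as the functionals are
        -- additive. The sum stays in `D s` because each new D is contained in the translate of the
        -- old one by the pick.
        focus : ∀ k s → Σ[ w ∈ X ] w ∈ D s × (S (run (suc k) s) ⊆ Pattern h (S s) w)
        focus zero s = pick s , pick∈D s , S-next s
        focus (suc k) s with focus k (next s)
        ... | x , x∈D , g = w ⊞ x , D-pick s x∈D , λ {y} y∈ i →
            let n , n∈ , n≡ = g y∈ i
                m , m∈ , m≡ = S-next s n∈ i
            in m , m∈ , trans m≡ (trans (cong (ℚ._+ h i w) n≡)
                 (trans (solve 3 (λ y a b → (y :+ b) :+ a := y :+ (a :+ b)) refl (ν y) (h i w) (h i x))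
                        (cong (ν y ℚ.+_) (sym (h-add i w x)))))
          where
          open +-*-Solver
          w : X
          w = pick s

      D-run : ∀ k s → D (run k s) ⊆ D s
      D-run zero s x    = x
      D-run (suc k) s x = D-next s (D-run k (next s) x)

      monochromatic : ∀ {D₀} → D₀ ∈ 𝓠 →
        Σ[ w ∈ X ] w ∈ D₀ × Σ[ c ∈ Fin r ] Σ[ y ∈ ℕ⁺ ] Colour y c × (y ∈ Pattern h (λ n → Colour n c) w)
      monochromatic {D₀} D₀∈ with large-class Colour coloured U (mkℕ⁺ 1 , p , whole (p +ᵘ p))
      -- Among the states 0, ..., r two have the same of the r colours; a point of the later set is
      -- moved into the earlier one.
      ... | c₀ , l₀ = conclude (Fin.pigeonhole (ℕ.n<1+n r) (λ (i : Fin (suc r)) → colour (run (toℕ i) s₀)))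
        where
        s₀ : State
        s₀ = record { large = l₀ ; colour = c₀ ; mono = proj₂ ; D∈ = D₀∈ }
        conclude : (∃[ i ] ∃[ j ] i Fin.< j × colour (run (toℕ i) s₀) ≡ colour (run (toℕ j) s₀)) →
          Σ[ w ∈ X ] w ∈ D₀ × Σ[ c ∈ Fin r ] Σ[ y ∈ ℕ⁺ ] Colour y c × (y ∈ Pattern h (λ n → Colour n c) w)
        -- `focus k` spans k + 1 steps, hence k = j - i - 1.
        conclude (i , j , i<j , eq) with focus (toℕ j ℕ.∸ suc (toℕ i)) (run (toℕ i) s₀)
                                       | large-inhabited _ (large (run (toℕ j) s₀))
        ... | w , w∈D , f | y , y∈S = w , D-run (toℕ i) s₀ w∈D , colour (run (toℕ i) s₀) , y
              , subst (Colour y) (sym eq) (mono (run (toℕ j) s₀) y∈S)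
              , λ l → let n , n∈ , n≡ = f (subst (λ s → S s y) run≡ y∈S) l
                      in n , mono (run (toℕ i) s₀) n∈ , n≡
          where
          run≡ : run (toℕ j) s₀ ≡ run (suc (toℕ j ℕ.∸ suc (toℕ i))) (run (toℕ i) s₀)
          run≡ = trans (cong (λ m → run m s₀) (sym (trans (ℕ.+-suc (toℕ i) _) (ℕ.m+[n∸m]≡n i<j))))
                       (run-+ (toℕ i) (suc (toℕ j ℕ.∸ suc (toℕ i))) s₀)

    module Step {u} (g : Fin (suc u) → X → ℚ) (g-add : ∀ i → Additive (g i))
                (g-int : ∀ i → (λ x → Integral (g i x)) ∈ 𝓠) where

      -- Passing to differences with `g zero` leaves one functional fewer. The shift by `g zero w`
      -- is put back in `restore`.
      h : Fin u → X → ℚ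
      h i x = g (suc i) x ℚ.- g zero x

      opaque
        h-add : ∀ i → Additive (h i)
        h-add i x y = trans (cong₂ ℚ._-_ (g-add (suc i) x y) (g-add zero x y))
          (solve 4 (λ a b c d → (a :+ b) :- (c :+ d) := (a :- c) :+ (b :- d)) refl
            (g (suc i) x) (g (suc i) y) (g zero x) (g zero y))
          where open +-*-Solver

        h-int : ∀ i → (λ x → Integral (h i x)) ∈ 𝓠
        h-int i = Q.upward (λ {x} (a , c) → Integral-− (g (suc i) x) (g zero x) a c) (Q.meet (g-int (suc i)) (g-int zero))

        restore : ∀ C w → Shift (g zero w) (C ∩ Pattern h C w) ⊆ Pattern g C w
        restore C w (n , (n∈C , _) , n≡) zero = n , n∈C , n≡
        restore C w {z} (n , (_ , pat) , n≡) (suc i) = let m , m∈C , m≡ = pat i in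
          m , m∈C , trans m≡ (trans (cong (ℚ._+ h i w) n≡)
            (solve 3 (λ z a b → (z :+ a) :+ (b :- a) := z :+ b) refl (ν z) (g zero w) (g (suc i) w)))
          where open +-*-Solver

      module _ {C : Pred ℕ⁺ 0ℓ} (b : ℕ⁺) (s : βℕ) where

        -- That is, b + n + m + v ∈ C for p-many m and, for each of these, s-many v. By recurrence
        -- of p finitely many translates of the hits cover `ℕ⁺`.
        Hit : Pred ℕ⁺ 0ℓ
        Hit n = - n +ˢ (λ m → - m +ˢ - b +ˢ C ∈ sets s) ∈ sets p

        opaque
          ν-sum : ∀ t n m v → ν (b +⁺ (((t +⁺ n) +⁺ m) +⁺ v)) ≡ ν b ℚ.+ (((ν t ℚ.+ ν n) ℚ.+ ν m) ℚ.+ ν v)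
          ν-sum t n m v = trans (ν-+ b (((t +⁺ n) +⁺ m) +⁺ v)) (cong (ν b ℚ.+_) (trans (ν-+ ((t +⁺ n) +⁺ m) v) (cong (ℚ._+ ν v)
                          (trans (ν-+ (t +⁺ n) m) (cong (ℚ._+ ν m) (ν-+ t n))))))

          regroup : ∀ t y m v → b +⁺ (((t +⁺ y) +⁺ m) +⁺ v) ≡ (b +⁺ (t +⁺ y)) +⁺ (m +⁺ v)
          regroup t y m v = trans (cong (b +⁺_) (+⁺-assoc (t +⁺ y) m v)) (sym (+⁺-assoc b (t +⁺ y) (m +⁺ v)))

          translate : ∀ t y n k m v → ν n ≡ ν y ℚ.+ k →
            ν (b +⁺ (((t +⁺ n) +⁺ m) +⁺ v)) ≡ ν ((b +⁺ (t +⁺ y)) +⁺ (m +⁺ v)) ℚ.+ k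
          translate t y n k m v n≡ = begin
            ν (b +⁺ (((t +⁺ n) +⁺ m) +⁺ v))
              ≡⟨ ν-sum t n m v ⟩
            ν b ℚ.+ (((ν t ℚ.+ ν n) ℚ.+ ν m) ℚ.+ ν v)
              ≡⟨ cong (λ k → ν b ℚ.+ (((ν t ℚ.+ k) ℚ.+ ν m) ℚ.+ ν v)) n≡ ⟩
            ν b ℚ.+ (((ν t ℚ.+ (ν y ℚ.+ k)) ℚ.+ ν m) ℚ.+ ν v)
              ≡⟨ solve 6 (λ b t y h m v → b :+ (((t :+ (y :+ h)) :+ m) :+ v) := (b :+ (((t :+ y) :+ m) :+ v)) :+ h)
                   refl (ν b) (ν t) (ν y) k (ν m) (ν v) ⟩
            (ν b ℚ.+ (((ν t ℚ.+ ν y) ℚ.+ ν m) ℚ.+ ν v)) ℚ.+ k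
              ≡⟨ cong (ℚ._+ k) (ν-sum t y m v) ⟨
            ν (b +⁺ (((t +⁺ y) +⁺ m) +⁺ v)) ℚ.+ k
              ≡⟨ cong (λ n → ν n ℚ.+ k) (regroup t y m v) ⟩
            ν ((b +⁺ (t +⁺ y)) +⁺ (m +⁺ v)) ℚ.+ k ∎
            where
            open ≡-Reasoning
            open +-*-Solver

          -- All of t + y and t + y + hᵢ(w) are hits, and there are finitely many of them, so common
          -- m and v serve for all; the new base point is b + t + y.
          spread : ∀ t y w → Hit (t +⁺ y) → y ∈ Pattern h (λ n → Hit (t +⁺ n)) w →
                   Large (C ∩ Pattern h C w)
          spread t y w y-hit hy-hit = b +⁺ (t +⁺ y) , s ,
            upward p (λ {m} (k , ks) → upward s (λ {v} (q , qs) →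
                subst C (regroup t y m v) q ,
                λ i → let n , _ , n≡ = hy-hit i in
                  b +⁺ (((t +⁺ n) +⁺ m) +⁺ v) , qs i , translate t y n (h i w) m v n≡)
              (meet s k (meet-all s ks)))
            (meet p y-hit (meet-all p λ i → proj₁ (proj₂ (hy-hit i))))

      opaque
        extend-patterns : HasPatterns h → HasPatterns g
        extend-patterns patterns {C} {D} (b , s , C-large) D∈ = finish (recurrent⇒syndetic {p} p-rec (λ m → - m +ˢ - b +ˢ C ∈ sets s) C-large)
          where
          finish : Σ[ ts ∈ List ℕ⁺ ] (∀ n → Any (λ t → Hit {C} b s (t +⁺ n)) ts) →
                   Σ[ w ∈ X ] w ∈ D × Large (Pattern g C w)
          finish (ts , syndetic) =
            let w , (w∈D , g₀-int) , c , y , y-hit , hy-hit =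
                  Focusing.monochromatic h h-add patterns
                    -- The finite colouring: n receives the position in `ts` of some t for which t +
                    -- n is a hit.
                    (λ n c → Hit {C} b s (List.lookup ts c +⁺ n))
                    (λ n → Any.index (syndetic n) , Any.lookup-index (syndetic n))
                    (Q.meet D∈ (g-int zero))
            in w , w∈D , large-upward (Shift (g zero w) (C ∩ Pattern h C w)) (Pattern g C w) (restore C w)
                 (large-shift (g zero w) g₀-int (C ∩ Pattern h C w)
                   (spread {C} b s (List.lookup ts c) y w y-hit hy-hit))

    patterns-exist : ∀ u (g : Fin u → X → ℚ) → (∀ i → Additive (g i)) →
                     (∀ i → (λ x → Integral (g i x)) ∈ 𝓠) → HasPatterns g
    patterns-exist zero g g-add g-int {C} l D∈ =
      let w , w∈D = Q.inhabited D∈ in w , w∈D , large-upward C (Pattern g C w) (λ _ ()) l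
    patterns-exist (suc u) g g-add g-int =
      extend-patterns (patterns-exist u h h-add h-int)
      where open Step g g-add g-int

-- Inequalities and finite sums over ℚ, and Farkas' lemma.

0≤+ : ∀ {a b} → 0ℚ ℚ.≤ a → 0ℚ ℚ.≤ b → 0ℚ ℚ.≤ a ℚ.+ b
0≤+ {a} {b} h k = subst (ℚ._≤ a ℚ.+ b) (ℚ.+-identityʳ 0ℚ) (ℚ.+-mono-≤ h k)

*-monoˡ-≤ : ∀ {a b c} → 0ℚ ℚ.≤ c → a ℚ.≤ b → c ℚ.* a ℚ.≤ c ℚ.* b
*-monoˡ-≤ {c = c} 0≤c h = ℚ.*-monoˡ-≤-nonNeg c {{ℚ.nonNegative 0≤c}} h

0≤* : ∀ {a b} → 0ℚ ℚ.≤ a → 0ℚ ℚ.≤ b → 0ℚ ℚ.≤ a ℚ.* b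
0≤* {a} {b} h k = subst (ℚ._≤ a ℚ.* b) (ℚ.*-zeroʳ a) (*-monoˡ-≤ h k)

a≤b⇒0≤b-a : ∀ {a b} → a ℚ.≤ b → 0ℚ ℚ.≤ b ℚ.- a
a≤b⇒0≤b-a {a} {b} h = subst (ℚ._≤ b ℚ.- a) (ℚ.+-inverseʳ a) (ℚ.+-monoˡ-≤ (ℚ.- a) h)

0≤b-a⇒a≤b : ∀ {a b} → 0ℚ ℚ.≤ b ℚ.- a → a ℚ.≤ b
0≤b-a⇒a≤b {a} {b} h = subst₂ ℚ._≤_ (ℚ.+-identityˡ a)
  (solve 2 (λ a b → (b :- a) :+ a := b) refl a b) (ℚ.+-monoˡ-≤ a h)
  where open +-*-Solver

sum-mono : ∀ {n} {f g : Fin n → ℚ} → (∀ i → f i ℚ.≤ g i) → sum f ℚ.≤ sum g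
sum-mono {zero} h  = ℚ.≤-refl
sum-mono {suc n} h = ℚ.+-mono-≤ (h zero) (sum-mono (λ i → h (suc i)))

sum-zero : ∀ {n} {f : Fin n → ℚ} → (∀ i → f i ≡ 0ℚ) → sum f ≡ 0ℚ
sum-zero {n} h = trans (sum-cong-≗ h) (sum-replicate-zero n)

0≤sum : ∀ {n} {f : Fin n → ℚ} → (∀ i → 0ℚ ℚ.≤ f i) → 0ℚ ℚ.≤ sum f
0≤sum {n} {f} h = subst (ℚ._≤ sum f) (sum-replicate-zero n) (sum-mono h)

sum-+ : ∀ m {n} (f : Fin (m ℕ.+ n) → ℚ) →
        sum f ≡ sum (λ i → f (i Fin.↑ˡ n)) ℚ.+ sum (λ j → f (m Fin.↑ʳ j))
sum-+ zero f = sym (ℚ.+-identityˡ _)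
sum-+ (suc m) f = trans (cong (f zero ℚ.+_) (sum-+ m (λ i → f (suc i)))) (sym (ℚ.+-assoc (f zero) _ _))

δ : ∀ {n} → Fin n → Fin n → ℚ
δ zero    zero    = 1ℚ
δ zero    (suc i) = 0ℚ
δ (suc j) zero    = 0ℚ
δ (suc j) (suc i) = δ j i

sum-δ : ∀ {n} (f : Fin n → ℚ) j → sum (λ i → f i ℚ.* δ j i) ≡ f j
sum-δ f zero    = trans (cong₂ ℚ._+_ (ℚ.*-identityʳ (f zero)) (sum-zero (λ i → ℚ.*-zeroʳ (f (suc i)))))
                        (ℚ.+-identityʳ (f zero))
sum-δ f (suc j) = trans (cong₂ ℚ._+_ (ℚ.*-zeroʳ (f zero)) (sum-δ (λ i → f (suc i)) j)) (ℚ.+-identityˡ (f (suc j)))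

opaque
  negative-reciprocal : ∀ {a} → a ℚ.< 0ℚ → Σ[ k ∈ ℚ ] 0ℚ ℚ.≤ k × k ℚ.* a ≡ ℚ.- 1ℚ
  negative-reciprocal {a} a<0 = ℚ.1/ (ℚ.- a) , ℚ.<⇒≤ (ℚ.positive⁻¹ (ℚ.1/ (ℚ.- a))) , (begin
    ℚ.1/ (ℚ.- a) ℚ.* a                  ≡⟨ cong (ℚ.1/ (ℚ.- a) ℚ.*_) (solve 1 (λ a → a := :- (:- a)) refl a) ⟩
    ℚ.1/ (ℚ.- a) ℚ.* ℚ.- (ℚ.- a)        ≡⟨ ℚ.neg-distribʳ-* (ℚ.1/ (ℚ.- a)) (ℚ.- a) ⟨
    ℚ.- (ℚ.1/ (ℚ.- a) ℚ.* ℚ.- a)        ≡⟨ cong ℚ.-_ (ℚ.*-inverseˡ (ℚ.- a)) ⟩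
    ℚ.- 1ℚ                              ∎)
    where
    open ≡-Reasoning
    open +-*-Solver
    instance
      -a>0 : ℚ.Positive (ℚ.- a)
      -a>0 = ℚ.positive (ℚ.neg-antimono-< a<0)
      -a≢0 : ℚ.NonZero (ℚ.- a)
      -a≢0 = ℚ.pos⇒nonZero (ℚ.- a)
      1/-a>0 : ℚ.Positive (ℚ.1/ (ℚ.- a))
      1/-a>0 = ℚ.1/pos⇒pos (ℚ.- a)

-- Farkas' lemma, by Bartl's induction on the number of functionals: if the
-- functionals a₁,…,aₘ do not suffice, some x̄ violates the conclusion, and
-- projecting along x̄ onto the kernel of a₀ disposes of a₀.
module Farkas (em : ExcludedMiddle (Level.suc 0ℓ)) {V : Set} (_⊹_·_ : V → ℚ → V → V) where
  open Classical em

  Linear : (V → ℚ) → Set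
  Linear f = ∀ x c y → f (x ⊹ c · y) ≡ f x ℚ.+ c ℚ.* f y

  farkas : ∀ m (a : Fin m → V → ℚ) (b : V → ℚ) → (∀ i → Linear (a i)) → Linear b →
           (∀ x → (∀ i → 0ℚ ℚ.≤ a i x) → 0ℚ ℚ.≤ b x) →
           Σ[ ξ ∈ (Fin m → ℚ) ] (∀ i → 0ℚ ℚ.≤ ξ i) × (∀ x → b x ≡ sum (λ i → ξ i ℚ.* a i x))
  farkas zero a b a-lin b-lin b≥0 = (λ ()) , (λ ()) , λ x → ℚ.≤-antisym
    -- Only x + c y is available in `V`, so -x is represented as x - 2x; b is nonnegative at both
    -- and hence zero.
    (0≤b-a⇒a≤b (subst (0ℚ ℚ.≤_)
      (trans (b-lin x (ℚ.- (1ℚ ℚ.+ 1ℚ)) x)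
        (solve 1 (λ b → b :+ (:- (con 1ℚ :+ con 1ℚ)) :* b := con 0ℚ :- b) refl (b x)))
      (b≥0 (x ⊹ ℚ.- (1ℚ ℚ.+ 1ℚ) · x) λ ())))
    (b≥0 x λ ())
    where open +-*-Solver
  farkas (suc m) a b a-lin b-lin b≥0
    with em₀ {∀ x → (∀ i → 0ℚ ℚ.≤ a (suc i) x) → 0ℚ ℚ.≤ b x}
  ... | yes b≥0′ =
    let ξ , ξ≥0 , b≡ = farkas m (λ i → a (suc i)) b (λ i → a-lin (suc i)) b-lin b≥0′
    in (λ { zero → 0ℚ ; (suc i) → ξ i })
     , (λ { zero → ℚ.≤-refl ; (suc i) → ξ≥0 i })
     , λ x → trans (b≡ x) (sym (trans (cong (ℚ._+ sum (λ i → ξ i ℚ.* a (suc i) x)) (ℚ.*-zeroˡ (a zero x)))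
                                      (ℚ.+-identityˡ _)))
  -- The multiplier of a₀ collects the a₀-terms of the expansion of b that the induction hypothesis
  -- gives after projection.
  ... | no ¬b≥0′ = (λ { zero → sum (λ i → ξ i ℚ.* (k ℚ.* a (suc i) x̄)) ℚ.+ k ℚ.* (ℚ.- b x̄) ; (suc i) → ξ i })
    , (λ { zero → 0≤+ (0≤sum λ i → 0≤* (ξ≥0 i) (0≤* k≥0 (x̄≥0 i)))
                      (0≤* k≥0 (ℚ.<⇒≤ (ℚ.neg-antimono-< bx̄<0)))
         ; (suc i) → ξ≥0 i })
    , final
    where
    open +-*-Solver
    violation : Σ[ x ∈ V ] (∀ i → 0ℚ ℚ.≤ a (suc i) x) × b x ℚ.< 0ℚ
    violation = by-contradiction λ none → ¬b≥0′ λ x h → ℚ.≮⇒≥ λ bx<0 → none (x , h , bx<0)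
    x̄ : V
    x̄ = proj₁ violation
    x̄≥0 : ∀ i → 0ℚ ℚ.≤ a (suc i) x̄
    x̄≥0 = proj₁ (proj₂ violation)
    bx̄<0 : b x̄ ℚ.< 0ℚ
    bx̄<0 = proj₂ (proj₂ violation)
    a₀x̄<0 : a zero x̄ ℚ.< 0ℚ
    a₀x̄<0 = ℚ.≰⇒> λ a₀x̄≥0 →
      ℚ.<-irrefl refl (ℚ.≤-<-trans (b≥0 x̄ λ { zero → a₀x̄≥0 ; (suc i) → x̄≥0 i }) bx̄<0)
    reciprocal : Σ[ k ∈ ℚ ] 0ℚ ℚ.≤ k × k ℚ.* a zero x̄ ≡ ℚ.- 1ℚ
    reciprocal = negative-reciprocal a₀x̄<0
    k : ℚ
    k = proj₁ reciprocal
    k≥0 : 0ℚ ℚ.≤ k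
    k≥0 = proj₁ (proj₂ reciprocal)
    project : V → V
    project x = x ⊹ k ℚ.* a zero x · x̄
    -- This is f after `project`, expanded by linearity. In this form its linearity follows without
    -- any laws for the operation on `V`.
    along : (V → ℚ) → V → ℚ
    along f x = f x ℚ.+ (k ℚ.* f x̄) ℚ.* a zero x
    along-project : ∀ f → Linear f → ∀ x → along f x ≡ f (project x)
    along-project f f-lin x = trans
      (solve 4 (λ k g a f → f :+ (k :* g) :* a := f :+ (k :* a) :* g) refl k (f x̄) (a zero x) (f x))
      (sym (f-lin x (k ℚ.* a zero x) x̄))
    along-linear : ∀ f → Linear f → Linear (along f)
    along-linear f f-lin x c y = trans
      (cong₂ (λ s t → s ℚ.+ (k ℚ.* f x̄) ℚ.* t) (f-lin x c y) (a-lin zero x c y))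
      (solve 6 (λ fx fy ax ay c d → (fx :+ c :* fy) :+ d :* (ax :+ c :* ay)
                                 := (fx :+ d :* ax) :+ c :* (fy :+ d :* ay)) refl
        (f x) (f y) (a zero x) (a zero y) c (k ℚ.* f x̄))
    a₀-project : ∀ x → a zero (project x) ≡ 0ℚ
    a₀-project x = trans (a-lin zero x (k ℚ.* a zero x) x̄)
      (trans (solve 3 (λ a k c → a :+ (k :* a) :* c := a :+ a :* (k :* c)) refl (a zero x) k (a zero x̄))
        (trans (cong (λ t → a zero x ℚ.+ a zero x ℚ.* t) (proj₂ (proj₂ reciprocal)))
          (solve 1 (λ a → a :+ a :* (:- con 1ℚ) := con 0ℚ) refl (a zero x))))
    ih : Σ[ ξ ∈ (Fin m → ℚ) ] (∀ i → 0ℚ ℚ.≤ ξ i) ×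
           (∀ x → along b x ≡ sum (λ i → ξ i ℚ.* along (a (suc i)) x))
    ih = farkas m (λ i → along (a (suc i))) (along b) (λ i → along-linear (a (suc i)) (a-lin (suc i))) (along-linear b b-lin)
      λ x h → subst (0ℚ ℚ.≤_) (sym (along-project b b-lin x)) (b≥0 (project x) λ
        { zero    → ℚ.≤-reflexive (sym (a₀-project x))
        ; (suc i) → subst (0ℚ ℚ.≤_) (along-project (a (suc i)) (a-lin (suc i)) x) (h i) })
    ξ : Fin m → ℚ
    ξ = proj₁ ih
    ξ≥0 : ∀ i → 0ℚ ℚ.≤ ξ i
    ξ≥0 = proj₁ (proj₂ ih)
    final : ∀ x → b x ≡ (sum (λ i → ξ i ℚ.* (k ℚ.* a (suc i) x̄)) ℚ.+ k ℚ.* (ℚ.- b x̄)) ℚ.* a zero x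
                          ℚ.+ sum (λ i → ξ i ℚ.* a (suc i) x)
    final x = begin
      b x
        ≡⟨ solve 4 (λ b k c a → b := (b :+ (k :* c) :* a) :- (k :* c) :* a) refl (b x) k (b x̄) (a zero x) ⟩
      along b x ℚ.- (k ℚ.* b x̄) ℚ.* a zero x
        ≡⟨ cong (ℚ._- (k ℚ.* b x̄) ℚ.* a zero x) (trans (proj₂ (proj₂ ih) x) expand) ⟩
      (T ℚ.+ S ℚ.* a zero x) ℚ.- (k ℚ.* b x̄) ℚ.* a zero x
        ≡⟨ solve 5 (λ T S a k c → (T :+ S :* a) :- (k :* c) :* a := (S :+ k :* (:- c)) :* a :+ T) refl
             T S (a zero x) k (b x̄) ⟩
      (S ℚ.+ k ℚ.* (ℚ.- b x̄)) ℚ.* a zero x ℚ.+ T ∎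
      where
      open ≡-Reasoning
      T S : ℚ
      T = sum (λ i → ξ i ℚ.* a (suc i) x)
      S = sum (λ i → ξ i ℚ.* (k ℚ.* a (suc i) x̄))
      expand : sum (λ i → ξ i ℚ.* along (a (suc i)) x) ≡ T ℚ.+ S ℚ.* a zero x
      expand = trans (sum-cong-≗ λ i →
          solve 4 (λ z f g a → z :* (f :+ g :* a) := z :* f :+ (z :* g) :* a) refl
            (ξ i) (a (suc i) x) (k ℚ.* a (suc i) x̄) (a zero x))
        (trans (∑-distrib-+ (λ i → ξ i ℚ.* a (suc i) x) (λ i → (ξ i ℚ.* (k ℚ.* a (suc i) x̄)) ℚ.* a zero x))
          (cong (T ℚ.+_) (sym (*-distribʳ-sum (a zero x) (λ i → ξ i ℚ.* (k ℚ.* a (suc i) x̄))))))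

-- Directions that move a single cluster of rows, by duality.

opaque
  archimedean : ∀ q → Σ[ N ∈ ℕ ] q ℚ.≤ fromℕ N
  archimedean q@(ℚ.mkℚ n d _) = ℤ.∣ n ∣ , ℚ.toℚᵘ-cancel-≤ (begin
    ℚᵘ.mkℚᵘ n d              ≤⟨ ℚᵘ.*≤* (bound n) ⟩
    ℚᵘ.mkℚᵘ (+ ℤ.∣ n ∣) 0    ≃⟨ toℚᵘ-fromℕ ℤ.∣ n ∣ ⟨
    ℚ.toℚᵘ (fromℕ ℤ.∣ n ∣)   ∎)
    where
    open ℚᵘ.≤-Reasoning
    bound : ∀ n → n ℤ.* + 1 ℤ.≤ + ℤ.∣ n ∣ ℤ.* + suc d
    bound (+ a)       = subst₂ ℤ._≤_ (ℤ.pos-* a 1) (ℤ.pos-* a (suc d)) (ℤ.+≤+ (ℕ.*-monoʳ-≤ a (ℕ.s≤s ℕ.z≤n)))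
    bound ℤ.-[1+ a ]  = ℤ.-≤+

0≤fromℕ : ∀ n → 0ℚ ℚ.≤ fromℕ n
0≤fromℕ n = subst (ℚ._≤ fromℕ n) fromℕ-0 (fromℕ-mono-≤ ℕ.z≤n)

-- Where the cluster of a row lies relative to the cluster being treated.
data Position : Set where
  lower same upper : Position

weight : Position → ℚ
weight same = 1ℚ
weight _    = 0ℚ

slackness : Position → ℚ
slackness upper = 1ℚ
slackness _     = 0ℚ

Fits : Position → ℚ → Set
Fits lower q = q ≡ 0ℚ
Fits same  q = q ≡ 1ℚ
Fits upper q = 0ℚ ℚ.≤ q

-- In the limit L → ∞, and rescaled to s = 1, this becomes Fits.
Close : ℚ → ℚ → Position → ℚ → Set
Close L s lower y = 0ℚ ℚ.≤ y × L ℚ.* y ℚ.≤ s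
Close L s same  y = s ℚ.≤ y × L ℚ.* (y ℚ.- s) ℚ.≤ s
Close L s upper y = 0ℚ ℚ.≤ y

a≤∣a∣ : ∀ a → a ℚ.≤ ℚ.∣ a ∣
a≤∣a∣ a with ℚ.∣p∣≡p∨∣p∣≡-p a
... | inj₁ e = ℚ.≤-reflexive (sym e)
... | inj₂ e = 0≤b-a⇒a≤b (subst (λ t → 0ℚ ℚ.≤ ℚ.∣ a ∣ ℚ.+ t) e (0≤+ (ℚ.0≤∣p∣ a) (ℚ.0≤∣p∣ a)))

-- The error is at most s∣c∣: on `lower` and `same` rows by closeness, on `upper` rows because c ≤ 0
-- there makes the left side nonpositive.
close-term : ∀ L s τ y c → 0ℚ ℚ.≤ L → 0ℚ ℚ.≤ s → Close L s τ y → 0ℚ ℚ.≤ ℚ.- (slackness τ ℚ.* c) →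
             L ℚ.* (c ℚ.* y) ℚ.≤ s ℚ.* (L ℚ.* (weight τ ℚ.* c) ℚ.+ ℚ.∣ c ∣)
close-term L s lower y c 0≤L 0≤s (0≤y , Ly≤s) _ = begin
  L ℚ.* (c ℚ.* y)                         ≡⟨ solve 3 (λ L c y → L :* (c :* y) := (L :* y) :* c) refl L c y ⟩
  (L ℚ.* y) ℚ.* c                         ≤⟨ *-monoˡ-≤ (0≤* 0≤L 0≤y) (a≤∣a∣ c) ⟩
  (L ℚ.* y) ℚ.* ℚ.∣ c ∣                   ≤⟨ ℚ.*-monoʳ-≤-nonNeg ℚ.∣ c ∣ {{ℚ.∣-∣-nonNeg c}} Ly≤s ⟩
  s ℚ.* ℚ.∣ c ∣                           ≡⟨ solve 4 (λ s L c d → s :* d := s :* (L :* (con 0ℚ :* c) :+ d)) refl s L c ℚ.∣ c ∣ ⟩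
  s ℚ.* (L ℚ.* (0ℚ ℚ.* c) ℚ.+ ℚ.∣ c ∣)    ∎
  where
  open ℚ.≤-Reasoning
  open +-*-Solver
close-term L s same y c 0≤L 0≤s (s≤y , h) _ = begin
  L ℚ.* (c ℚ.* y)
    ≡⟨ solve 4 (λ L c y s → L :* (c :* y) := (L :* (y :- s)) :* c :+ s :* (L :* (con 1ℚ :* c))) refl L c y s ⟩
  (L ℚ.* (y ℚ.- s)) ℚ.* c ℚ.+ s ℚ.* (L ℚ.* (1ℚ ℚ.* c))
    ≤⟨ ℚ.+-monoˡ-≤ (s ℚ.* (L ℚ.* (1ℚ ℚ.* c))) (*-monoˡ-≤ (0≤* 0≤L (a≤b⇒0≤b-a s≤y)) (a≤∣a∣ c)) ⟩
  (L ℚ.* (y ℚ.- s)) ℚ.* ℚ.∣ c ∣ ℚ.+ s ℚ.* (L ℚ.* (1ℚ ℚ.* c))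
    ≤⟨ ℚ.+-monoˡ-≤ (s ℚ.* (L ℚ.* (1ℚ ℚ.* c))) (ℚ.*-monoʳ-≤-nonNeg ℚ.∣ c ∣ {{ℚ.∣-∣-nonNeg c}} h) ⟩
  s ℚ.* ℚ.∣ c ∣ ℚ.+ s ℚ.* (L ℚ.* (1ℚ ℚ.* c))
    ≡⟨ solve 4 (λ s L c d → s :* d :+ s :* (L :* (con 1ℚ :* c)) := s :* (L :* (con 1ℚ :* c) :+ d)) refl s L c ℚ.∣ c ∣ ⟩
  s ℚ.* (L ℚ.* (1ℚ ℚ.* c) ℚ.+ ℚ.∣ c ∣)    ∎
  where
  open ℚ.≤-Reasoning
  open +-*-Solver
close-term L s upper y c 0≤L 0≤s 0≤y 0≤-c = 0≤b-a⇒a≤b (subst (0ℚ ℚ.≤_)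
  (solve 5 (λ L c y s d → L :* ((:- (con 1ℚ :* c)) :* y) :+ s :* d
                       := s :* (L :* (con 0ℚ :* c) :+ d) :- L :* (c :* y)) refl L c y s ℚ.∣ c ∣)
  (0≤+ (0≤* 0≤L (0≤* 0≤-c 0≤y)) (0≤* 0≤s (ℚ.0≤∣p∣ c))))
  where open +-*-Solver

module Stages (em : ExcludedMiddle (Level.suc 0ℓ)) {u v : ℕ} (M : Fin u → Fin v → ℚ) where
  open Classical em

  infix 8 M·_
  M·_ : (Fin v → ℚ) → Fin u → ℚ
  (M· x) i = sum (λ l → M i l ℚ.* x l)

  Stage : (Fin u → Position) → Set
  Stage τ = Σ[ ξ ∈ (Fin v → ℚ) ] (∀ l → 0ℚ ℚ.≤ ξ l) × (∀ i → Fits (τ i) ((M· ξ) i))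

  open Farkas em {Fin u → ℚ} (λ x c y i → x i ℚ.+ c ℚ.* y i)

  pairing-linear : ∀ (m : Fin u → ℚ) → Linear (λ x → sum (λ i → m i ℚ.* x i))
  pairing-linear m x c y = trans
    (sum-cong-≗ λ i → solve 4 (λ m x c y → m :* (x :+ c :* y) := m :* x :+ c :* (m :* y)) refl (m i) (x i) c (y i))
    (trans (∑-distrib-+ (λ i → m i ℚ.* x i) (λ i → c ℚ.* (m i ℚ.* y i)))
           (cong (sum (λ i → m i ℚ.* x i) ℚ.+_) (sym (*-distribˡ-sum c (λ i → m i ℚ.* y i)))))
    where open +-*-Solver

  module _ (τ : Fin u → Position) where

    class-sum : (Fin u → ℚ) → ℚ
    class-sum x = sum (λ i → weight (τ i) ℚ.* x i)

    column : Fin v → (Fin u → ℚ) → ℚ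
    column l x = sum (λ i → M i l ℚ.* x i)

    slack : Fin u → (Fin u → ℚ) → ℚ
    slack i x = ℚ.- (slackness (τ i) ℚ.* x i)

    functional : Fin v ⊎ Fin u → (Fin u → ℚ) → ℚ
    functional = [ column , slack ]′

    functional-linear : ∀ k → Linear (functional k)
    functional-linear (inj₁ l) = pairing-linear (λ i → M i l)
    functional-linear (inj₂ i) x c y =
      solve 4 (λ e x c y → :- (e :* (x :+ c :* y)) := :- (e :* x) :+ c :* (:- (e :* y))) refl
        (slackness (τ i)) (x i) c (y i)
      where open +-*-Solver

    Separator : Set
    Separator = Σ[ c ∈ (Fin u → ℚ) ]
      (∀ l → 0ℚ ℚ.≤ column l c) × (∀ i → 0ℚ ℚ.≤ slack i c) × class-sum c ℚ.< 0ℚ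

    combined : Fin (v ℕ.+ u) → (Fin u → ℚ) → ℚ
    combined k = functional (Fin.splitAt v k)

    combined-↑ˡ : ∀ l c → combined (l Fin.↑ˡ u) c ≡ column l c
    combined-↑ˡ l c = cong (λ k → functional k c) (Fin.splitAt-↑ˡ v l u)

    combined-↑ʳ : ∀ i c → combined (v Fin.↑ʳ i) c ≡ slack i c
    combined-↑ʳ i c = cong (λ k → functional k c) (Fin.splitAt-↑ʳ v u i)

    fits : ∀ σ h q → 0ℚ ℚ.≤ h → q ≡ weight σ ℚ.+ slackness σ ℚ.* h → Fits σ q
    fits lower h q _ e   = trans e (solve 1 (λ h → con 0ℚ :+ con 0ℚ :* h := con 0ℚ) refl h)
      where open +-*-Solver
    fits same h q _ e    = trans e (solve 1 (λ h → con 1ℚ :+ con 0ℚ :* h := con 1ℚ) refl h)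
      where open +-*-Solver
    fits upper h q h≥0 e = subst (0ℚ ℚ.≤_)
      (sym (trans e (solve 1 (λ h → con 0ℚ :+ con 1ℚ :* h := h) refl h))) h≥0
      where open +-*-Solver

    module _ (ζ : Fin (v ℕ.+ u) → ℚ)
             (expansion : ∀ c → class-sum c ≡ sum (λ k → ζ k ℚ.* combined k c)) where

      private
        ξ : Fin v → ℚ
        ξ l = ζ (l Fin.↑ˡ u)

        η : Fin u → ℚ
        η i = ζ (v Fin.↑ʳ i)

      columns : ∀ j → sum (λ l → ξ l ℚ.* combined (l Fin.↑ˡ u) (δ j)) ≡ (M· ξ) j
      columns j = sum-cong-≗ λ l → trans
        (cong (ξ l ℚ.*_) (trans (combined-↑ˡ l (δ j)) (sum-δ (λ i → M i l) j)))
        (ℚ.*-comm (ξ l) (M j l))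

      slacks : ∀ j → sum (λ i → η i ℚ.* combined (v Fin.↑ʳ i) (δ j)) ≡ ℚ.- (slackness (τ j) ℚ.* η j)
      slacks j = trans (sum-cong-≗ λ i → trans
          (cong (η i ℚ.*_) (combined-↑ʳ i (δ j)))
          (solve 3 (λ h e d → h :* (:- (e :* d)) := (:- (e :* h)) :* d) refl (η i) (slackness (τ i)) (δ j i)))
        (sum-δ (λ i → ℚ.- (slackness (τ i) ℚ.* η i)) j)
        where open +-*-Solver

      -- The unit vector `δ j` reads off the j-th coefficient of both sides of the expansion.
      balance : ∀ j → (M· ξ) j ℚ.+ ℚ.- (slackness (τ j) ℚ.* η j) ≡ weight (τ j)
      balance j = begin
        (M· ξ) j ℚ.+ ℚ.- (slackness (τ j) ℚ.* η j)          ≡⟨ cong₂ ℚ._+_ (columns j) (slacks j) ⟨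
        sum (λ l → ξ l ℚ.* combined (l Fin.↑ˡ u) (δ j)) ℚ.+
        sum (λ i → η i ℚ.* combined (v Fin.↑ʳ i) (δ j))     ≡⟨ sum-+ v (λ k → ζ k ℚ.* combined k (δ j)) ⟨
        sum (λ k → ζ k ℚ.* combined k (δ j))                ≡⟨ expansion (δ j) ⟨
        class-sum (δ j)                                     ≡⟨ sum-δ (λ i → weight (τ i)) j ⟩
        weight (τ j)                                        ∎
        where open ≡-Reasoning

      row : ∀ j → (M· ξ) j ≡ weight (τ j) ℚ.+ slackness (τ j) ℚ.* η j
      row j = trans
        (solve 2 (λ a b → a := (a :+ :- b) :+ b) refl ((M· ξ) j) (slackness (τ j) ℚ.* η j))
        (cong (ℚ._+ slackness (τ j) ℚ.* η j) (balance j))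
        where open +-*-Solver

      expansion⇒stage : (∀ k → 0ℚ ℚ.≤ ζ k) → Stage τ
      expansion⇒stage ζ≥0 = ξ , (λ l → ζ≥0 (l Fin.↑ˡ u)) ,
        λ j → fits (τ j) (η j) ((M· ξ) j) (ζ≥0 (v Fin.↑ʳ j)) (row j)

    -- Farkas' lemma expresses `class-sum` through columns and slacks. The multipliers of the
    -- columns form ξ, and those of the slacks are the entries of M ξ on the `upper` rows.
    stage-or-separator : ¬ Separator → Stage τ
    stage-or-separator none =
      let ζ , ζ≥0 , expansion = farkas (v ℕ.+ u) combined class-sum
            (λ k → functional-linear (Fin.splitAt v k)) (pairing-linear (λ i → weight (τ i)))
            (λ c h → ℚ.≮⇒≥ λ neg → none (c
              , (λ l → subst (0ℚ ℚ.≤_) (combined-↑ˡ l c) (h (l Fin.↑ˡ u)))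
              , (λ i → subst (0ℚ ℚ.≤_) (combined-↑ʳ i c) (h (v Fin.↑ʳ i)))
              , neg))
      in expansion⇒stage ζ expansion ζ≥0

    -- Pairing a separator c with M x: on the one hand c·Mx ≥ 0, on the other
    -- hand c·Mx is within s·Σ∣cᵢ∣/L of s·class-sum c, which is negative.
    separator-bound : Separator → Σ[ L ∈ ℕ ] (∀ x s → (∀ l → 0ℚ ℚ.≤ x l) → 0ℚ ℚ.< s →
                      ¬ (∀ i → Close (fromℕ L) s (τ i) ((M· x) i)))
    separator-bound (c , col≥0 , slack≥0 , neg) = L₀ , λ x s x≥0 s>0 close →
      let open ℚ.≤-Reasoning
          open +-*-Solver
          0≤s = ℚ.<⇒≤ s>0 in
      ℚ.<-irrefl refl (begin-strict
        0ℚ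
          ≤⟨ 0≤* (0≤fromℕ L₀) (0≤sum λ l → 0≤* (x≥0 l) (col≥0 l)) ⟩
        L ℚ.* sum (λ l → x l ℚ.* column l c)
          ≡⟨ cong (L ℚ.*_) (exchange x) ⟩
        L ℚ.* sum (λ i → c i ℚ.* (M· x) i)
          ≡⟨ *-distribˡ-sum L (λ i → c i ℚ.* (M· x) i) ⟩
        sum (λ i → L ℚ.* (c i ℚ.* (M· x) i))
          ≤⟨ sum-mono (λ i → close-term L s (τ i) ((M· x) i) (c i) (0≤fromℕ L₀) 0≤s (close i) (slack≥0 i)) ⟩
        sum (λ i → s ℚ.* (L ℚ.* (weight (τ i) ℚ.* c i) ℚ.+ ℚ.∣ c i ∣))
          ≡⟨ *-distribˡ-sum s (λ i → L ℚ.* (weight (τ i) ℚ.* c i) ℚ.+ ℚ.∣ c i ∣) ⟨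
        s ℚ.* sum (λ i → L ℚ.* (weight (τ i) ℚ.* c i) ℚ.+ ℚ.∣ c i ∣)
          ≡⟨ cong (s ℚ.*_) (trans (∑-distrib-+ (λ i → L ℚ.* (weight (τ i) ℚ.* c i)) (λ i → ℚ.∣ c i ∣))
               (cong (ℚ._+ Λ) (sym (*-distribˡ-sum L (λ i → weight (τ i) ℚ.* c i))))) ⟩
        s ℚ.* (L ℚ.* class-sum c ℚ.+ Λ)
          <⟨ ℚ.*-monoʳ-<-pos s {{ℚ.positive s>0}} L-large ⟩
        s ℚ.* 0ℚ
          ≡⟨ ℚ.*-zeroʳ s ⟩
        0ℚ ∎)
      where
      Λ : ℚ
      Λ = sum (λ i → ℚ.∣ c i ∣)
      reciprocal : Σ[ k ∈ ℚ ] 0ℚ ℚ.≤ k × k ℚ.* class-sum c ≡ ℚ.- 1ℚ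
      reciprocal = negative-reciprocal neg
      k : ℚ
      k = proj₁ reciprocal
      L₀ : ℕ
      -- Since k is the reciprocal of -`class-sum c`, this choice makes L times `class-sum c` at
      -- most -(Λ + 1).
      L₀ = proj₁ (archimedean ((Λ ℚ.+ 1ℚ) ℚ.* k))
      L : ℚ
      L = fromℕ L₀
      L-large : L ℚ.* class-sum c ℚ.+ Λ ℚ.< 0ℚ
      L-large = begin-strict
        L ℚ.* class-sum c ℚ.+ Λ
          ≤⟨ ℚ.+-monoˡ-≤ Λ (ℚ.*-monoʳ-≤-nonPos (class-sum c) {{ℚ.nonPositive (ℚ.<⇒≤ neg)}}
               (proj₂ (archimedean ((Λ ℚ.+ 1ℚ) ℚ.* k)))) ⟩
        ((Λ ℚ.+ 1ℚ) ℚ.* k) ℚ.* class-sum c ℚ.+ Λ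
          ≡⟨ cong (ℚ._+ Λ) (ℚ.*-assoc (Λ ℚ.+ 1ℚ) k (class-sum c)) ⟩
        (Λ ℚ.+ 1ℚ) ℚ.* (k ℚ.* class-sum c) ℚ.+ Λ
          ≡⟨ cong (λ t → (Λ ℚ.+ 1ℚ) ℚ.* t ℚ.+ Λ) (proj₂ (proj₂ reciprocal)) ⟩
        (Λ ℚ.+ 1ℚ) ℚ.* ℚ.- 1ℚ ℚ.+ Λ
          ≡⟨ solve 1 (λ t → (t :+ con 1ℚ) :* :- con 1ℚ :+ t := :- con 1ℚ) refl Λ ⟩
        ℚ.- 1ℚ
          <⟨ ℚ.negative⁻¹ (ℚ.- 1ℚ) ⟩
        0ℚ ∎
        where
        open ℚ.≤-Reasoning
        open +-*-Solver
      exchange : ∀ x → sum (λ l → x l ℚ.* column l c) ≡ sum (λ i → c i ℚ.* (M· x) i)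
      exchange x = begin
        sum (λ l → x l ℚ.* column l c)
          ≡⟨ sum-cong-≗ (λ l → *-distribˡ-sum (x l) (λ i → M i l ℚ.* c i)) ⟩
        sum (λ l → sum (λ i → x l ℚ.* (M i l ℚ.* c i)))
          ≡⟨ ∑-comm (λ l i → x l ℚ.* (M i l ℚ.* c i)) ⟩
        sum (λ i → sum (λ l → x l ℚ.* (M i l ℚ.* c i)))
          ≡⟨ sum-cong-≗ (λ i → trans
               (sum-cong-≗ λ l → solve 3 (λ x m c → x :* (m :* c) := c :* (m :* x)) refl (x l) (M i l) (c i))
               (sym (*-distribˡ-sum (c i) (λ l → M i l ℚ.* x l)))) ⟩
        sum (λ i → c i ℚ.* (M· x) i) ∎
        where
        open ≡-Reasoning
        open +-*-Solver

bounded-over : ∀ {A : Set} (as : List A) → (∀ a → Any (a ≡_) as) → ∀ n (P : Vec A n → ℕ) →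
               Σ[ L ∈ ℕ ] (∀ τ → P τ ℕ.≤ L)
bounded-over as all∈ zero P = P Vec.[] , λ { Vec.[] → ℕ.≤-refl }
bounded-over {A} as all∈ (suc n) P = maximum as , λ { (a Vec.∷ τ) →
    ℕ.≤-trans (proj₂ (rest a) τ) (upper-bound (all∈ a)) }
  where
  rest : ∀ a → Σ[ L ∈ ℕ ] (∀ τ → P (a Vec.∷ τ) ℕ.≤ L)
  rest a = bounded-over as all∈ n (λ τ → P (a Vec.∷ τ))
  maximum : List A → ℕ
  maximum []       = 0
  maximum (a ∷ as) = proj₁ (rest a) ℕ.⊔ maximum as
  upper-bound : ∀ {a as} → Any (a ≡_) as → proj₁ (rest a) ℕ.≤ maximum as
  upper-bound (here refl) = ℕ.m≤m⊔n _ _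
  upper-bound (there h)   = ℕ.≤-trans (upper-bound h) (ℕ.m≤n⊔m _ _)

close-weaken : ∀ {K L s y} σ → K ℕ.≤ L → Close (fromℕ L) s σ y → Close (fromℕ K) s σ y
close-weaken {y = y} lower K≤L (0≤y , h) =
  0≤y , ℚ.≤-trans (ℚ.*-monoʳ-≤-nonNeg y {{ℚ.nonNegative 0≤y}} (fromℕ-mono-≤ K≤L)) h
close-weaken {s = s} {y} same K≤L (s≤y , h) =
  s≤y , ℚ.≤-trans (ℚ.*-monoʳ-≤-nonNeg (y ℚ.- s) {{ℚ.nonNegative (a≤b⇒0≤b-a s≤y)}} (fromℕ-mono-≤ K≤L)) h
close-weaken upper K≤L 0≤y = 0≤y

module UniformStages (em : ExcludedMiddle (Level.suc 0ℓ)) {u v : ℕ} (M : Fin u → Fin v → ℚ) where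
  open Classical em
  open Stages em M

  Forces : ℕ → (Fin u → Position) → Set
  Forces L τ = ∀ x s → (∀ l → 0ℚ ℚ.≤ x l) → 0ℚ ℚ.< s →
               (∀ i → Close (fromℕ L) s (τ i) ((M· x) i)) → Stage τ

  -- Without a separator the stage exists outright and L = 0 will do; with one, L is taken so large
  -- that the hypotheses of `Forces` cannot hold.
  forcing : ∀ τ → Σ[ L ∈ ℕ ] Forces L τ
  forcing τ = case (em₀ {Separator τ})
    where
    case : Dec (Separator τ) → Σ[ L ∈ ℕ ] Forces L τ
    case (no none) = 0 , λ _ _ _ _ _ → stage-or-separator τ none
    case (yes sep) =
      let L , bound = separator-bound τ sep
      in L , λ x s x≥0 s>0 close → contradiction close (bound x s x≥0 s>0)

  opaque
    -- There are finitely many assignments of positions, so one L serves for all. They are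
    -- enumerated as vectors, which requires the passage through `Vec.tabulate`.
    uniform-forcing : Σ[ L ∈ ℕ ] (∀ τ → Forces L τ)
    uniform-forcing =
      let L , bound = bounded-over (lower ∷ same ∷ upper ∷ [])
            (λ { lower → here refl ; same → there (here refl) ; upper → there (there (here refl)) })
            u (λ τ → proj₁ (forcing (Vec.lookup τ)))
      in L , λ τ x s x≥0 s>0 close →
        let ξ , ξ≥0 , ξ-fits = proj₂ (forcing (Vec.lookup (Vec.tabulate τ))) x s x≥0 s>0 λ i →
              subst (λ σ → Close (fromℕ (proj₁ (forcing (Vec.lookup (Vec.tabulate τ))))) s σ ((M· x) i))
                (sym (Vec.lookup∘tabulate τ i)) (close-weaken (τ i) (bound (Vec.tabulate τ)) (close i))
        in ξ , ξ≥0 , λ i → subst (λ σ → Fits σ ((M· ξ) i)) (Vec.lookup∘tabulate τ i) (ξ-fits i)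

-- Colouring by blocks of small relative length.

-- The blocks [t k, t (k+1)) have relative length about 1/L, so numbers in the
-- same block differ by a factor of at most 1 + 1/L, whereas numbers in blocks
-- whose indices differ by at least L² + 1 differ by a factor of at least L.
module Blocks (L : ℕ) .{{L≢0 : NonZero L}} where

  t : ℕ → ℕ
  t zero    = 1
  t (suc k) = suc (t k ℕ.+ t k / L)

  t>0 : ∀ k → 0 ℕ.< t k
  t>0 zero    = ℕ.s≤s ℕ.z≤n
  t>0 (suc k) = ℕ.s≤s ℕ.z≤n

  t-step : ∀ k → t k ℕ.< t (suc k)
  t-step k = ℕ.s≤s (ℕ.m≤m+n (t k) (t k / L))

  t-mono : ∀ k j → t k ℕ.≤ t (k ℕ.+ j)
  t-mono k zero    = ℕ.≤-reflexive (cong t (sym (ℕ.+-identityʳ k)))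
  t-mono k (suc j) = ℕ.≤-trans (t-mono k j)
    (ℕ.≤-trans (ℕ.<⇒≤ (t-step (k ℕ.+ j))) (ℕ.≤-reflexive (cong t (sym (ℕ.+-suc k j)))))

  t-growth : ∀ k → L ℕ.* t k ℕ.+ t k ℕ.≤ L ℕ.* t (suc k)
  t-growth k = begin
    L ℕ.* t k ℕ.+ t k                                 ≡⟨ cong (L ℕ.* t k ℕ.+_) (m≡m%n+[m/n]*n (t k) L) ⟩
    L ℕ.* t k ℕ.+ (t k % L ℕ.+ t k / L ℕ.* L)         ≤⟨ ℕ.+-monoʳ-≤ (L ℕ.* t k) (ℕ.+-monoˡ-≤ (t k / L ℕ.* L) (ℕ.<⇒≤ (m%n<n (t k) L))) ⟩
    L ℕ.* t k ℕ.+ (L ℕ.+ t k / L ℕ.* L)               ≡⟨ cong (λ z → L ℕ.* t k ℕ.+ (L ℕ.+ z)) (ℕ.*-comm (t k / L) L) ⟩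
    L ℕ.* t k ℕ.+ (L ℕ.+ L ℕ.* (t k / L))             ≡⟨ cong (L ℕ.* t k ℕ.+_) (ℕ.*-suc L (t k / L)) ⟨
    L ℕ.* t k ℕ.+ L ℕ.* suc (t k / L)                 ≡⟨ ℕ.*-distribˡ-+ L (t k) (suc (t k / L)) ⟨
    L ℕ.* (t k ℕ.+ suc (t k / L))                     ≡⟨ cong (L ℕ.*_) (ℕ.+-suc (t k) (t k / L)) ⟩
    L ℕ.* t (suc k)                                   ∎
    where open ℕ.≤-Reasoning

  -- Each of the j steps adds at least t k / L, by `t-growth` and monotonicity; j = L² then gives
  -- `t-leap`.
  t-linear-growth : ∀ k j → (L ℕ.+ j) ℕ.* t k ℕ.≤ L ℕ.* t (k ℕ.+ j)
  t-linear-growth k zero = ℕ.≤-reflexive (cong₂ (λ a b → a ℕ.* t b) (ℕ.+-identityʳ L) (sym (ℕ.+-identityʳ k)))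
  t-linear-growth k (suc j) = begin
    (L ℕ.+ suc j) ℕ.* t k                     ≡⟨ cong (ℕ._* t k) (trans (ℕ.+-suc L j) (ℕ.+-comm 1 (L ℕ.+ j))) ⟩
    (L ℕ.+ j ℕ.+ 1) ℕ.* t k                   ≡⟨ ℕ.*-distribʳ-+ (t k) (L ℕ.+ j) 1 ⟩
    (L ℕ.+ j) ℕ.* t k ℕ.+ 1 ℕ.* t k           ≤⟨ ℕ.+-mono-≤ (t-linear-growth k j)
                                                  (ℕ.≤-trans (ℕ.≤-reflexive (ℕ.*-identityˡ (t k))) (t-mono k j)) ⟩
    L ℕ.* t (k ℕ.+ j) ℕ.+ t (k ℕ.+ j)         ≤⟨ t-growth (k ℕ.+ j) ⟩
    L ℕ.* t (suc (k ℕ.+ j))                   ≡⟨ cong (λ z → L ℕ.* t z) (ℕ.+-suc k j) ⟨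
    L ℕ.* t (k ℕ.+ suc j)                     ∎
    where open ℕ.≤-Reasoning

  t-leap : ∀ k → L ℕ.* t k ℕ.≤ t (k ℕ.+ L ℕ.* L)
  t-leap k = ℕ.*-cancelˡ-≤ L (begin
    L ℕ.* (L ℕ.* t k)                ≡⟨ ℕ.*-assoc L L (t k) ⟨
    (L ℕ.* L) ℕ.* t k                ≤⟨ ℕ.*-monoˡ-≤ (t k) (ℕ.m≤n+m (L ℕ.* L) L) ⟩
    (L ℕ.+ L ℕ.* L) ℕ.* t k          ≤⟨ t-linear-growth k (L ℕ.* L) ⟩
    L ℕ.* t (k ℕ.+ L ℕ.* L)          ∎)
    where open ℕ.≤-Reasoning

  Block : ℕ → ℕ → Set
  Block n k = t k ℕ.≤ n × n ℕ.< t (suc k)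

  locate : ∀ n → Σ[ k ∈ ℕ ] Block (suc n) k
  locate zero = 0 , ℕ.≤-refl , ℕ.s≤s (ℕ.s≤s ℕ.z≤n)
  locate (suc n) with locate n
  ... | k , t≤n , n<t with suc (suc n) ℕ.<? t (suc k)
  ...   | yes h = k , ℕ.m≤n⇒m≤1+n t≤n , h
  ...   | no ¬h = suc k , ℕ.≮⇒≥ ¬h , ℕ.≤-<-trans n<t (t-step (suc k))

  same-block : ∀ {n k} → Block n k → L ℕ.* (n ℕ.∸ t k) ℕ.≤ t k
  same-block {n} {k} (_ , n<) = begin
    L ℕ.* (n ℕ.∸ t k)         ≤⟨ ℕ.*-monoʳ-≤ L (ℕ.≤-trans (ℕ.∸-monoˡ-≤ (t k) (ℕ.s≤s⁻¹ n<))
                                   (ℕ.≤-reflexive (ℕ.m+n∸m≡n (t k) (t k / L)))) ⟩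
    L ℕ.* (t k / L)           ≡⟨ ℕ.*-comm L (t k / L) ⟩
    t k / L ℕ.* L             ≤⟨ m/n*n≤m (t k) L ⟩
    t k                       ∎
    where open ℕ.≤-Reasoning

  -- One more than the L² steps of `t-leap`, because a number in block k is bounded only by the end
  -- t (k + 1) of that block.
  period : ℕ
  period = suc (L ℕ.* L)

  distant-blocks : ∀ {n k k′} → Block n k → k ℕ.< k′ → k % period ≡ k′ % period → L ℕ.* n ℕ.≤ t k′
  distant-blocks {n} {k} {k′} (_ , n<) k<k′ k≡k′ = begin
    L ℕ.* n                               ≤⟨ ℕ.*-monoʳ-≤ L (ℕ.<⇒≤ n<) ⟩
    L ℕ.* t (suc k)                       ≤⟨ t-leap (suc k) ⟩
    t (suc k ℕ.+ L ℕ.* L)                 ≤⟨ t-mono (suc k ℕ.+ L ℕ.* L) (k′ ℕ.∸ (suc k ℕ.+ L ℕ.* L)) ⟩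
    t (suc k ℕ.+ L ℕ.* L ℕ.+ (k′ ℕ.∸ (suc k ℕ.+ L ℕ.* L)))
                                          ≡⟨ cong t (ℕ.m+[n∸m]≡n apart) ⟩
    t k′                                  ∎
    where
    open ℕ.≤-Reasoning
    quotients : k / period ℕ.< k′ / period
    quotients = ℕ.≰⇒> λ h → ℕ.<⇒≱ k<k′ (begin
      k′                                          ≡⟨ m≡m%n+[m/n]*n k′ period ⟩
      k′ % period ℕ.+ k′ / period ℕ.* period      ≤⟨ ℕ.+-mono-≤ (ℕ.≤-reflexive (sym k≡k′)) (ℕ.*-monoˡ-≤ period h) ⟩
      k % period ℕ.+ k / period ℕ.* period        ≡⟨ m≡m%n+[m/n]*n k period ⟨
      k                                           ∎)
    apart : suc k ℕ.+ L ℕ.* L ℕ.≤ k′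
    apart = begin
      suc k ℕ.+ L ℕ.* L                                   ≡⟨ ℕ.+-suc k (L ℕ.* L) ⟨
      k ℕ.+ period                                        ≡⟨ cong (ℕ._+ period) (m≡m%n+[m/n]*n k period) ⟩
      k % period ℕ.+ k / period ℕ.* period ℕ.+ period     ≡⟨ ℕ.+-assoc (k % period) (k / period ℕ.* period) period ⟩
      k % period ℕ.+ (k / period ℕ.* period ℕ.+ period)   ≡⟨ cong (k % period ℕ.+_) (ℕ.+-comm (k / period ℕ.* period) period) ⟩
      k % period ℕ.+ suc (k / period) ℕ.* period          ≤⟨ ℕ.+-mono-≤ (ℕ.≤-reflexive k≡k′) (ℕ.*-monoˡ-≤ period quotients) ⟩
      k′ % period ℕ.+ k′ / period ℕ.* period              ≡⟨ m≡m%n+[m/n]*n k′ period ⟨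
      k′                                                  ∎

  rank : ℕ⁺ → ℕ
  rank n = proj₁ (locate (ℕ.pred (value n)))

  rank-block : ∀ n → Block (value n) (rank n)
  rank-block n = subst (λ m → Block m (rank n)) (ℕ.m+[n∸m]≡n (value>0 n)) (proj₂ (locate (ℕ.pred (value n))))

  colour : ℕ⁺ → Fin period
  colour n = fromℕ< (m%n<n (rank n) period)

  colour-rank : ∀ m n → colour m ≡ colour n → rank m % period ≡ rank n % period
  colour-rank m n e = trans (sym (Fin.toℕ-fromℕ< (m%n<n (rank m) period)))
    (trans (cong toℕ e) (Fin.toℕ-fromℕ< (m%n<n (rank n) period)))

-- From a monochromatic image to a staged matrix.

position : ℕ → ℕ → Position
position r k with ℕ.<-cmp r k
... | tri< _ _ _ = lower
... | tri≈ _ _ _ = same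
... | tri> _ _ _ = upper

position-elim : ∀ (P : Position → Set) r k → (r ℕ.< k → P lower) → (r ≡ k → P same) → (k ℕ.< r → P upper) →
                P (position r k)
position-elim P r k f g h with ℕ.<-cmp r k
... | tri< a _ _ = f a
... | tri≈ _ b _ = g b
... | tri> _ _ c = h c

dot≡sum : ∀ {n} (v w : Vec ℚ n) → v · w ≡ sum (λ l → Vec.lookup v l ℚ.* Vec.lookup w l)
dot≡sum Vec.[] Vec.[]             = refl
dot≡sum (a Vec.∷ v) (b Vec.∷ w) = cong (a ℚ.* b ℚ.+_) (dot≡sum v w)

coefficient : (B : ℚMatrix) → Fin (rows B) → Fin (cols B) → ℚ
coefficient B i l = Vec.lookup (Vec.lookup (entries B) i) l

image-entry : ∀ B x i →
  Vec.lookup (image B x) i ≡ sum (λ l → coefficient B i l ℚ.* ν (Vec.lookup x l))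
image-entry B x i = trans (Vec.lookup-map i (_· Vec.map ι x) (entries B))
  (trans (dot≡sum (Vec.lookup (entries B) i) (Vec.map ι x))
         (sum-cong-≗ λ l → cong (coefficient B i l ℚ.*_) (trans (Vec.lookup-map l ι x) (ι≡ν (Vec.lookup x l)))))

ν≥0 : ∀ n → 0ℚ ℚ.≤ ν n
ν≥0 n = subst (0ℚ ℚ.≤_) (sym (ν≡fromℕ n)) (0≤fromℕ (value n))

-- Stage k of a staged matrix allows an arbitrary positive number to be added
-- to the rows of rank k without changing the rows of smaller rank.
record Staged {u v : ℕ} (M : Fin u → Fin v → ℚ) : Set where
  field
    rank  : Fin u → ℕ
    start : Vec ℕ⁺ v
    row-value : Fin u → ℕ⁺
    start-value : ∀ i → sum (λ l → M i l ℚ.* ν (Vec.lookup start l)) ≡ ν (row-value i)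
    direction   : ℕ → Fin v → ℚ
    direction≥0 : ∀ k l → 0ℚ ℚ.≤ direction k l
    direction-fits : ∀ k i → Fits (position (rank i) k) (sum (λ l → M i l ℚ.* direction k l))

module IPRStages (em : ExcludedMiddle (Level.suc 0ℓ)) (B : ℚMatrix) (ipr : ImagePartitionRegular B) where
  open Classical em

  private
    M : Fin (rows B) → Fin (cols B) → ℚ
    M = coefficient B

  open Stages em M
  open UniformStages em M

  private
    L₀ : ℕ
    L₀ = proj₁ uniform-forcing

  -- `Blocks` divides by its parameter, which `suc` makes nonzero; `close-weaken` returns to L₀.
  open Blocks (suc L₀)

  module _ (x : Vec ℕ⁺ (cols B)) (c : Fin period) (mono : entrySet (image B x) ⊆ ι⟦ (λ n → colour n ≡ c) ⟧) where

    entry : Fin (rows B) → ℕ⁺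
    entry i = proj₁ (mono (i , refl))

    entry-value : ∀ i → (M· (λ l → ν (Vec.lookup x l))) i ≡ ν (entry i)
    entry-value i = trans (sym (image-entry B x i)) (trans (proj₂ (proj₂ (mono (i , refl)))) (ι≡ν (entry i)))

    r : Fin (rows B) → ℕ
    r i = rank (entry i)

    same-colour : ∀ i j → r i % period ≡ r j % period
    same-colour i j = colour-rank (entry i) (entry j)
      (trans (proj₁ (proj₂ (mono (i , refl)))) (sym (proj₁ (proj₂ (mono (j , refl))))))

    -- Here s is the left end of the block of row j. Rows of the same rank lie in that block; rows
    -- of smaller rank have the same colour and thus lie in a distant block.
    close : ∀ j i → Close (fromℕ (suc L₀)) (fromℕ (t (r j))) (position (r i) (r j)) (ν (entry i))
    close j i = position-elim (λ σ → Close (fromℕ (suc L₀)) (fromℕ (t (r j))) σ (ν (entry i))) (r i) (r j)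
      (λ i<j → ν≥0 (entry i) , subst (ℚ._≤ fromℕ (t (r j)))
        (trans (fromℕ-* (suc L₀) (value (entry i))) (cong (fromℕ (suc L₀) ℚ.*_) (sym (ν≡fromℕ (entry i)))))
        (fromℕ-mono-≤ (distant-blocks (rank-block (entry i)) i<j (same-colour i j))))
      (λ i≡j → same-case (r j) (subst (Block (value (entry i))) i≡j (rank-block (entry i))))
      (λ _ → ν≥0 (entry i))
      where
      same-case : ∀ k → Block (value (entry i)) k → Close (fromℕ (suc L₀)) (fromℕ (t k)) same (ν (entry i))
      same-case k b@(t≤n , _) =
        subst (fromℕ (t k) ℚ.≤_) (sym (ν≡fromℕ (entry i))) (fromℕ-mono-≤ t≤n) ,
        subst (ℚ._≤ fromℕ (t k))
          (trans (fromℕ-* (suc L₀) (value (entry i) ℕ.∸ t k)) (cong (fromℕ (suc L₀) ℚ.*_) difference))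
          (fromℕ-mono-≤ (same-block b))
        where
        open +-*-Solver
        difference : fromℕ (value (entry i) ℕ.∸ t k) ≡ ν (entry i) ℚ.- fromℕ (t k)
        difference = trans
          (solve 2 (λ a b → a := (a :+ b) :- b) refl (fromℕ (value (entry i) ℕ.∸ t k)) (fromℕ (t k)))
          (cong (ℚ._- fromℕ (t k)) (trans (sym (fromℕ-+ (value (entry i) ℕ.∸ t k) (t k)))
            (trans (cong fromℕ (ℕ.m∸n+n≡m t≤n)) (sym (ν≡fromℕ (entry i))))))

    attained-stage : ∀ j → Stage (λ i → position (r i) (r j))
    attained-stage j = proj₂ uniform-forcing (λ i → position (r i) (r j))
      (λ l → ν (Vec.lookup x l)) (fromℕ (t (r j))) (λ l → ν≥0 (Vec.lookup x l))
      (ℚ.<-≤-trans (subst (0ℚ ℚ.<_) (sym fromℕ-1) (ℚ.positive⁻¹ 1ℚ)) (fromℕ-mono-≤ (t>0 (r j))))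
      λ i → close-weaken (position (r i) (r j)) (ℕ.n≤1+n L₀)
        (subst (Close (fromℕ (suc L₀)) (fromℕ (t (r j))) (position (r i) (r j))) (sym (entry-value i)) (close j i))

    -- At a rank carried by no row nothing has to move, so the zero vector serves.
    trivial-stage : ∀ k → (∀ i → r i ≢ k) → Stage (λ i → position (r i) k)
    trivial-stage k unattained = (λ _ → 0ℚ) , (λ _ → ℚ.≤-refl) , λ i →
      let zero-row = sum-zero (λ l → ℚ.*-zeroʳ (M i l)) in
      position-elim (λ σ → Fits σ ((M· (λ _ → 0ℚ)) i)) (r i) k
        (λ _ → zero-row) (λ e → contradiction e (unattained i)) (λ _ → ℚ.≤-reflexive (sym zero-row))

    stage : ∀ k → Stage (λ i → position (r i) k)
    stage k = decide em₀
      where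
      decide : Dec (Σ[ j ∈ Fin (rows B) ] r j ≡ k) → Stage (λ i → position (r i) k)
      decide (yes (j , e)) = subst (λ k → Stage (λ i → position (r i) k)) e (attained-stage j)
      decide (no none)     = trivial-stage k λ i e → none (i , e)

  opaque
    staged : Staged M
    staged = let x , c , mono = ipr colour in record
      { rank           = r x c mono
      ; start          = x
      ; row-value         = entry x c mono
      ; start-value    = entry-value x c mono
      ; direction      = λ k → proj₁ (stage x c mono k)
      ; direction≥0    = λ k → proj₁ (proj₂ (stage x c mono k))
      ; direction-fits = λ k → proj₂ (proj₂ (stage x c mono k))
      }

-- Denominators and integrality.

opaque
  clear-denominator : ∀ q → 0ℚ ℚ.≤ q → Σ[ d ∈ ℕ ] Σ[ a ∈ ℕ ] fromℕ (suc d) ℚ.* q ≡ fromℕ a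
  clear-denominator q@(ℚ.mkℚ (+ a) d _) _ = d , a , ℚ.toℚᵘ-injective (begin
    ℚ.toℚᵘ (fromℕ (suc d) ℚ.* q)                ≈⟨ ℚ.toℚᵘ-homo-* (fromℕ (suc d)) q ⟩
    ℚ.toℚᵘ (fromℕ (suc d)) ℚᵘ.* ℚᵘ.mkℚᵘ (+ a) d ≈⟨ ℚᵘ.*-cong (toℚᵘ-fromℕ (suc d)) ℚᵘ.≃-refl ⟩
    ℚᵘ.mkℚᵘ (+ suc d) 0 ℚᵘ.* ℚᵘ.mkℚᵘ (+ a) d    ≈⟨ ℚᵘ.*≡* cross ⟩
    ℚᵘ.mkℚᵘ (+ a) 0                             ≈⟨ toℚᵘ-fromℕ a ⟨
    ℚ.toℚᵘ (fromℕ a)                            ∎)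
    where
    open ℚᵘ.≃-Reasoning
    cross : (+ suc d ℤ.* + a) ℤ.* + 1 ≡ + a ℤ.* (+ suc (d ℕ.+ 0))
    cross = trans (ℤ.*-identityʳ (+ suc d ℤ.* + a)) (trans (ℤ.*-comm (+ suc d) (+ a))
      (cong (λ n → + a ℤ.* + suc n) (sym (ℕ.+-identityʳ d))))
  clear-denominator (ℚ.mkℚ ℤ.-[1+ _ ] _ _) (ℚ.*≤* ())

IsNatural : Pred ℚ 0ℓ
IsNatural q = Σ[ n ∈ ℕ ] q ≡ fromℕ n

ν-+fromℕ : ∀ m k → Σ[ n ∈ ℕ⁺ ] ν m ℚ.+ fromℕ k ≡ ν n
ν-+fromℕ m k = mkℕ⁺ (value m ℕ.+ k) {{ℕ.>-nonZero (ℕ.≤-trans (value>0 m) (ℕ.m≤m+n (value m) k))}} ,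
  trans (cong (ℚ._+ fromℕ k) (ν≡fromℕ m)) (trans (sym (fromℕ-+ (value m) k)) (sym (ν≡fromℕ _)))

ν-* : ∀ m n → Σ[ k ∈ ℕ⁺ ] ν m ℚ.* ν n ≡ ν k
ν-* m n = mkℕ⁺ (value m ℕ.* value n) {{ℕ.>-nonZero (ℕ.*-mono-≤ (value>0 m) (value>0 n))}} ,
  trans (cong₂ ℚ._*_ (ν≡fromℕ m) (ν≡fromℕ n)) (trans (sym (fromℕ-* (value m) (value n))) (sym (ν≡fromℕ _)))

Integral-0 : Integral 0ℚ
Integral-0 = mkℕ⁺ 1 , mkℕ⁺ 1 , ℚ.+-identityˡ _

Integral-ν : ∀ n → Integral (ν n)
Integral-ν n = n +⁺ mkℕ⁺ 1 , mkℕ⁺ 1 , sym (ν-+ n (mkℕ⁺ 1))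

above-all : ∀ {n} (f : Fin n → ℕ) → Σ[ K ∈ ℕ ] (∀ i → f i ℕ.< K)
above-all {zero} f = 0 , λ ()
above-all {suc n} f = let K , h = above-all (λ i → f (suc i)) in
  suc (f zero) ℕ.⊔ K , λ { zero → ℕ.m≤m⊔n (suc (f zero)) K ; (suc i) → ℕ.≤-trans (h i) (ℕ.m≤n⊔m (suc (f zero)) K) }

-- Images of a matrix inside members of p.

module CentralImages (em : ExcludedMiddle (Level.suc 0ℓ)) (ext : Extensionality 0ℓ 0ℓ)
                     (p : βℕ) (p-idem : p +ᵘ p ≈ᵘ p) (p-rec : Recurrent p) where
  open Classical em
  open Recurrence em ext
  open VanDerWaerden em ext p p-idem p-rec

  returns : ∀ {C} → C ∈ sets p → (λ n → - n +ˢ C ∈ sets p) ∈ sets p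
  returns {C} = p-unfold {C}

  -- Some residue class belongs to p. As p is idempotent, the class contains x, y and x + y for
  -- suitable x and y, so its residue is 0.
  multiples-member : ∀ d → (λ z → suc d ∣ value z) ∈ sets p
  multiples-member d with some-class p (λ z (c : Fin (suc d)) → value z % suc d ≡ toℕ c) (whole p)
                            (λ {z} _ → fromℕ< (m%n<n (value z) (suc d)) , sym (Fin.toℕ-fromℕ< (m%n<n (value z) (suc d))))
  ... | c , h with inhabited p (meet p h (returns {U ∩ (λ z → value z % suc d ≡ toℕ c)} h))
  ...   | x , (_ , x-class) , x-shift with inhabited p (meet p h x-shift)
  ...     | y , (_ , y-class) , (_ , xy-class) =
    upward p (λ {z} (_ , z-class) → m%n≡0⇒n∣m (value z) (suc d)
      (trans z-class (trans (sym y-class) (n∣m⇒m%n≡0 (value y) (suc d) d∣y)))) h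
    where
    X = value x
    Y = value y
    open ≡-Reasoning
    quotients : X / suc d ℕ.* suc d ℕ.+ Y ≡ (X ℕ.+ Y) / suc d ℕ.* suc d
    quotients = ℕ.+-cancelˡ-≡ (X % suc d) _ _ (begin
      X % suc d ℕ.+ (X / suc d ℕ.* suc d ℕ.+ Y)                ≡⟨ ℕ.+-assoc (X % suc d) (X / suc d ℕ.* suc d) Y ⟨
      (X % suc d ℕ.+ X / suc d ℕ.* suc d) ℕ.+ Y                ≡⟨ cong (ℕ._+ Y) (m≡m%n+[m/n]*n X (suc d)) ⟨
      X ℕ.+ Y                                                  ≡⟨ m≡m%n+[m/n]*n (X ℕ.+ Y) (suc d) ⟩
      (X ℕ.+ Y) % suc d ℕ.+ (X ℕ.+ Y) / suc d ℕ.* suc d        ≡⟨ cong (ℕ._+ (X ℕ.+ Y) / suc d ℕ.* suc d)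
                                                                    (trans (cong (_% suc d) (sym (value-+⁺ x y))) (trans xy-class (sym x-class))) ⟩
      X % suc d ℕ.+ (X ℕ.+ Y) / suc d ℕ.* suc d                ∎)
    d∣y : suc d ∣ Y
    d∣y = ∣m+n∣m⇒∣n (divides ((X ℕ.+ Y) / suc d) quotients) (n∣m*n (X / suc d))

  opaque
    natural-multiples : ∀ q → 0ℚ ℚ.≤ q → (λ z → IsNatural (ν z ℚ.* q)) ∈ sets p
    natural-multiples q q≥0 = let d , a , dq≡a = clear-denominator q q≥0 in
      upward p (λ { {z} (divides k z≡kd) → k ℕ.* a , (begin
        ν z ℚ.* q                              ≡⟨ cong (ℚ._* q) (trans (ν≡fromℕ z) (trans (cong fromℕ z≡kd) (fromℕ-* k (suc d)))) ⟩
        (fromℕ k ℚ.* fromℕ (suc d)) ℚ.* q      ≡⟨ ℚ.*-assoc (fromℕ k) (fromℕ (suc d)) q ⟩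
        fromℕ k ℚ.* (fromℕ (suc d) ℚ.* q)      ≡⟨ cong (fromℕ k ℚ.*_) dq≡a ⟩
        fromℕ k ℚ.* fromℕ a                    ≡⟨ fromℕ-* k a ⟨
        fromℕ (k ℕ.* a)                        ∎) })
      (multiples-member d)
      where open ≡-Reasoning

  member⇒large : ∀ C → C ∈ sets p → Large C
  member⇒large C C∈ = let b , h = inhabited p (returns {C} C∈) in b , p , returns {λ y → C (b +⁺ y)} h

  module _ {u v : ℕ} (M : Fin u → Fin v → ℚ) (S : Staged M) where
    open Staged S

    X : Set
    X = Fin v → ℚ

    infixl 6 _⊞_
    _⊞_ : X → X → X
    (x ⊞ y) l = x l ℚ.+ y l

    infixl 7 _⊡_
    _⊡_ : ℕ⁺ → X → X
    (z ⊡ x) l = ν z ℚ.* x l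

    M· : X → Fin u → ℚ
    M· x i = sum (λ l → M i l ℚ.* x l)

    M·-⊞ : ∀ x y i → M· (x ⊞ y) i ≡ M· x i ℚ.+ M· y i
    M·-⊞ x y i = trans (sum-cong-≗ λ l → ℚ.*-distribˡ-+ (M i l) (x l) (y l))
      (∑-distrib-+ (λ l → M i l ℚ.* x l) (λ l → M i l ℚ.* y l))

    M·-⊡ : ∀ z x i → M· (z ⊡ x) i ≡ ν z ℚ.* M· x i
    M·-⊡ z x i = trans
      (sum-cong-≗ λ l → solve 3 (λ m z x → m :* (z :* x) := z :* (m :* x)) refl (M i l) (ν z) (x l))
      (sym (*-distribˡ-sum (ν z) (λ l → M i l ℚ.* x l)))
      where open +-*-Solver

    Good : ℕ → Pred ℕ⁺ 0ℓ → Pred X 0ℓ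
    Good k C x = (∀ l → Σ[ n ∈ ℕ⁺ ] x l ≡ ν n) ×
                 (∀ i → Σ[ m ∈ ℕ⁺ ] M· x i ≡ ν m × (rank i ℕ.< k → m ∈ C))

    -- The induction over ranks carries an idempotent filter of vectors instead of one vector,
    -- because `patterns-exist` needs such a filter at the next rank.
    record FilterAt (k : ℕ) : Set₂ where
      field
        𝓠    : Pred (Pred X 0ℓ) (Level.suc 0ℓ)
        isQ  : IsIdempotentFilter _⊞_ 𝓠
        good : ∀ {C} → C ∈ sets p → Good k C ∈ 𝓠

    -- The principal filter on the positive multiples of the starting vector, idempotent because
    -- these are closed under ⊞. No row has rank below 0, so nothing has to lie in C yet.
    filter-zero : FilterAt 0
    filter-zero = record
      { 𝓠    = λ D → Lift (Level.suc 0ℓ) (∀ n → n ⊡ s ∈ D)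
      ; isQ  = record
        { inhabited  = λ (lift h) → mkℕ⁺ 1 ⊡ s , h (mkℕ⁺ 1)
        ; upward     = λ D⊆E (lift h) → lift λ n → D⊆E (h n)
        ; meet       = λ (lift h) (lift k) → lift λ n → h n , k n
        ; idempotent = λ {D} (lift h) → (λ x → Σ[ n ∈ ℕ⁺ ] x ≡ n ⊡ s) , lift (λ n → n , refl) ,
            λ { (n , refl) → lift λ m → subst D (add n m) (h (n +⁺ m)) }
        }
      ; good = λ _ → lift λ n →
          (λ l → let k , e = ν-* n (Vec.lookup start l) in k , e) ,
          (λ i → let k , e = ν-* n (row-value i) in
                 k , trans (M·-⊡ n s i) (trans (cong (ν n ℚ.*_) (start-value i)) e) , λ ())
      }
      where
      s : X
      s l = ν (Vec.lookup start l)
      add : ∀ n m → (n +⁺ m) ⊡ s ≡ n ⊡ s ⊞ m ⊡ s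
      add n m = ext λ l → trans (cong (ℚ._* s l) (ν-+ n m)) (ℚ.*-distribʳ-+ (s l) (ν n) (ν m))

    module NextFilter (k : ℕ) (F : FilterAt k) where
      open FilterAt F
      private module Q = IsIdempotentFilter isQ

      ξ : X
      ξ = direction k

      Adjusts : Pred ℕ⁺ 0ℓ → X → Pred ℕ⁺ 0ℓ
      Adjusts C x z = ∀ i → rank i ≡ k → z ∈ Shift (M· x i) C

      Covers : Pred X 0ℓ → Pred ℕ⁺ 0ℓ → Pred X 0ℓ → Set
      Covers D C E = ∀ x z → x ∈ D → z ∈ C → z ∈ Adjusts C x → x ⊞ z ⊡ ξ ∈ E

      -- Its generators consist of the x + z ξ with x ∈ D, z ∈ C and z + (M x)ᵢ ∈ C for the rows of
      -- rank k. As M ξ is 1 on these rows, the last condition puts their new values into C.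
      𝓠′ : Pred (Pred X 0ℓ) (Level.suc 0ℓ)
      𝓠′ E = Σ[ D ∈ Pred X 0ℓ ] D ∈ 𝓠 × Σ[ C ∈ Pred ℕ⁺ 0ℓ ] C ∈ sets p × Covers D C E

      -- The zero functional comes first: it puts z itself into C.
      row-functional : Fin (suc u) → X → ℚ
      row-functional zero    x = 0ℚ
      row-functional (suc i) x with rank i ℕ.≟ k
      ... | yes _ = M· x i
      ... | no _  = 0ℚ

      row-functional-rank : ∀ i x → rank i ≡ k → row-functional (suc i) x ≡ M· x i
      row-functional-rank i x e with rank i ℕ.≟ k
      ... | yes _ = refl
      ... | no ¬e = contradiction e ¬e

      row-functional-additive : ∀ i x y → row-functional i (x ⊞ y) ≡ row-functional i x ℚ.+ row-functional i y
      row-functional-additive zero    x y = refl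
      row-functional-additive (suc i) x y with rank i ℕ.≟ k
      ... | yes _ = M·-⊞ x y i
      ... | no _  = refl

      row-functional-integral : ∀ i {x} → Good k U x → Integral (row-functional i x)
      row-functional-integral zero    _ = Integral-0
      row-functional-integral (suc i) (_ , h) with rank i ℕ.≟ k
      ... | yes _ = let m , e , _ = h i in subst Integral (sym e) (Integral-ν m)
      ... | no _  = Integral-0

      opaque
        𝓠′-inhabited : ∀ {E} → E ∈ 𝓠′ → Σ[ x ∈ X ] x ∈ E
        𝓠′-inhabited (D , D∈ , C , C∈ , covers) =
          let w , w∈D , L = patterns-exist isQ (suc u) row-functional row-functional-additive
                (λ i → Q.upward (row-functional-integral i) (good {U} (whole p))) (member⇒large C C∈) D∈
              z , pat = large-inhabited (Pattern isQ row-functional C w) L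
              n , n∈C , n≡ = pat zero
          in w ⊞ z ⊡ ξ , covers w z w∈D
               (subst C (ν-injective (trans n≡ (ℚ.+-identityʳ (ν z)))) n∈C)
               (λ i e → let m , m∈C , m≡ = pat (suc i)
                        in m , m∈C , trans m≡ (cong (ν z ℚ.+_) (row-functional-rank i w e)))

      regroup : ∀ x y z w → (x ⊞ y) ⊞ (z +⁺ w) ⊡ ξ ≡ (x ⊞ z ⊡ ξ) ⊞ (y ⊞ w ⊡ ξ)
      regroup x y z w = ext λ l → trans (cong (λ t → (x l ℚ.+ y l) ℚ.+ t ℚ.* ξ l) (ν-+ z w))
        (solve 5 (λ x y z w k → (x :+ y) :+ (z :+ w) :* k := (x :+ z :* k) :+ (y :+ w :* k)) refl
          (x l) (y l) (ν z) (ν w) (ξ l))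
        where open +-*-Solver

      module _ (C : Pred ℕ⁺ 0ℓ) (C∈ : C ∈ sets p) where

        Returning : Pred ℕ⁺ 0ℓ
        Returning n = n ∈ C × - n +ˢ C ∈ sets p

        module _ (x : X) (z : ℕ⁺) (z∈ : z ∈ Returning) (adj : z ∈ Adjusts Returning x) where

          -- The witness `proj₁ (adj i e)` is the number z + (M x)ᵢ, so these n may be added to z
          -- and to all new row values of rank k without leaving C.
          Residual : Pred ℕ⁺ 0ℓ
          Residual n = n ∈ C × z +⁺ n ∈ C × (∀ i (e : rank i ≡ k) → proj₁ (adj i e) +⁺ n ∈ C)

          residual-member : Residual ∈ sets p
          residual-member = meet p C∈ (meet p (proj₂ z∈) (meet-all p row))
            where
            row : ∀ i → (λ n → (e : rank i ≡ k) → proj₁ (adj i e) +⁺ n ∈ C) ∈ sets p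
            row i with rank i ℕ.≟ k
            -- The witness depends on the proof of `rank i ≡ k`, of which there is only one.
            ... | yes e = upward p (λ {n} c e′ → subst (λ e → C (proj₁ (adj i e) +⁺ n)) (ℕ.≡-irrelevant e e′) c)
                            (proj₂ (proj₁ (proj₂ (adj i e))))
            ... | no ¬e = upward p (λ _ e → contradiction e ¬e) (whole p)

          residual-adjusts : ∀ y w → w ∈ Adjusts Residual y → (z +⁺ w) ∈ Adjusts C (x ⊞ y)
          residual-adjusts y w adj′ i e =
            let m , _ , m≡ = adj i e
                n , (_ , _ , rows∈) , n≡ = adj′ i e
            in m +⁺ n , rows∈ i e , trans (ν-+ m n) (trans (cong₂ ℚ._+_ m≡ n≡)
                 (trans (solve 4 (λ z a w b → (z :+ a) :+ (w :+ b) := (z :+ w) :+ (a :+ b)) refl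
                           (ν z) (M· x i) (ν w) (M· y i))
                        (sym (cong₂ ℚ._+_ (ν-+ z w) (M·-⊞ x y i)))))
            where open +-*-Solver

      -- D and C are shrunk to points whose translates of D and C are again members, and (x + z ξ) +
      -- (y + w ξ) is read as (x + y) + (z + w) ξ.
      𝓠′-idempotent : ∀ {E} → E ∈ 𝓠′ →
        Σ[ E′ ∈ Pred X 0ℓ ] E′ ∈ 𝓠′ × (∀ {x} → x ∈ E′ → (λ y → E (x ⊞ y)) ∈ 𝓠′)
      𝓠′-idempotent {E} (D , D∈ , C , C∈ , covers) =
        let D′ , D′∈ , D-shift = Q.idempotent D∈ in
        (λ x′ → Σ[ x ∈ X ] Σ[ z ∈ ℕ⁺ ] x ∈ D′ × z ∈ Returning C C∈ ×
                  z ∈ Adjusts (Returning C C∈) x × x′ ≡ x ⊞ z ⊡ ξ) ,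
        (D′ , D′∈ , Returning C C∈ , meet p C∈ (returns {C} C∈) ,
          λ x z x∈ z∈ adj → x , z , x∈ , z∈ , adj , refl) ,
        λ { (x , z , x∈ , z∈ , adj , refl) →
          (λ y → D (x ⊞ y)) , D-shift x∈ , Residual C C∈ x z z∈ adj , residual-member C C∈ x z z∈ adj ,
          λ y w y∈ w∈ adj′ → subst E (regroup x y z w)
            (covers (x ⊞ y) (z +⁺ w) y∈ (proj₁ (proj₂ w∈)) (residual-adjusts C C∈ x z z∈ adj y w adj′)) }

      M·ξ≥0 : ∀ i → 0ℚ ℚ.≤ M· ξ i
      M·ξ≥0 i = position-elim (λ σ → Fits σ (M· ξ i) → 0ℚ ℚ.≤ M· ξ i) (rank i) k
        (λ _ e → ℚ.≤-reflexive (sym e))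
        (λ _ e → subst (0ℚ ℚ.≤_) (sym e) (ℚ.nonNegative⁻¹ 1ℚ))
        (λ _ h → h) (direction-fits k i)

      Clearing : Pred ℕ⁺ 0ℓ
      Clearing z = (∀ l → IsNatural (ν z ℚ.* ξ l)) × (∀ i → IsNatural (ν z ℚ.* M· ξ i))

      clearing-member : Clearing ∈ sets p
      clearing-member = meet p (meet-all p λ l → natural-multiples (ξ l) (direction≥0 k l))
                               (meet-all p λ i → natural-multiples (M· ξ i) (M·ξ≥0 i))

      add-natural : ∀ {a b} → (Σ[ n ∈ ℕ⁺ ] a ≡ ν n) → IsNatural b → Σ[ n ∈ ℕ⁺ ] a ℚ.+ b ≡ ν n
      add-natural (n , a≡) (j , b≡) = let m , e = ν-+fromℕ n j in m , trans (cong₂ ℚ._+_ a≡ b≡) e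

      -- Rows of smaller rank are unchanged, rows of rank k become z + (M x)ᵢ ∈ C, and rows of
      -- larger rank gain a natural number because z clears the denominators.
      new-row : ∀ C x z → Good k C x → z ∈ Clearing → z ∈ Adjusts (C ∩ Clearing) x → ∀ i →
                Σ[ m ∈ ℕ⁺ ] M· x i ℚ.+ ν z ℚ.* M· ξ i ≡ ν m × (rank i ℕ.< suc k → m ∈ C)
      new-row C x z (_ , rows-good) (_ , clear) adj i =
        position-elim (λ σ → Fits σ (M· ξ i) → Σ[ m ∈ ℕ⁺ ] M· x i ℚ.+ ν z ℚ.* M· ξ i ≡ ν m × (rank i ℕ.< suc k → m ∈ C))
          (rank i) k
          (λ r<k M·ξ≡0 → let m , e , m∈ = rows-good i in m ,
            trans (cong (λ t → M· x i ℚ.+ ν z ℚ.* t) M·ξ≡0)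
              (trans (solve 2 (λ a z → a :+ z :* con 0ℚ := a) refl (M· x i) (ν z)) e) ,
            λ _ → m∈ r<k)
          (λ r≡k M·ξ≡1 → let m , (m∈C , _) , e = adj i r≡k in m ,
            trans (cong (λ t → M· x i ℚ.+ ν z ℚ.* t) M·ξ≡1)
              (trans (solve 2 (λ a z → a :+ z :* con 1ℚ := z :+ a) refl (M· x i) (ν z)) (sym e)) ,
            λ _ → m∈C)
          (λ k<r _ → let m , e , _ = rows-good i
                         m′ , e′ = add-natural (m , e) (clear i)
                     in m′ , e′ , λ r<1+k → contradiction (ℕ.s≤s⁻¹ r<1+k) (ℕ.<⇒≱ k<r))
          (direction-fits k i)
        where open +-*-Solver

      good′ : ∀ {C} → C ∈ sets p → Good (suc k) C ∈ 𝓠′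
      good′ {C} C∈ = Good k C , good C∈ , C ∩ Clearing , meet p C∈ clearing-member ,
        λ x z x-good (_ , z-clear) adj →
          (λ l → add-natural (proj₁ x-good l) (proj₁ z-clear l)) ,
          (λ i → let m , e , m∈ = new-row C x z x-good z-clear adj i
                 in m , trans (M·-⊞ x (z ⊡ ξ) i) (trans (cong (M· x i ℚ.+_) (M·-⊡ z ξ i)) e) , m∈)

      filter-next : FilterAt (suc k)
      filter-next = record
        { 𝓠    = 𝓠′
        ; isQ  = record
          { inhabited  = 𝓠′-inhabited
          ; upward     = λ D⊆E (D , D∈ , C , C∈ , cov) → D , D∈ , C , C∈ , λ x z x∈ z∈ adj → D⊆E (cov x z x∈ z∈ adj)
          ; meet       = λ (D , D∈ , C , C∈ , cov) (D′ , D′∈ , C′ , C′∈ , cov′) →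
              D ∩ D′ , Q.meet D∈ D′∈ , C ∩ C′ , meet p C∈ C′∈ , λ x z (x∈ , x∈′) (z∈ , z∈′) adj →
                cov x z x∈ z∈ (λ i e → let m , (m∈ , _) , h = adj i e in m , m∈ , h) ,
                cov′ x z x∈′ z∈′ (λ i e → let m , (_ , m∈) , h = adj i e in m , m∈ , h)
          ; idempotent = λ {E} → 𝓠′-idempotent {E}
          }
        ; good = good′
        }

    filter-at : ∀ k → FilterAt k
    filter-at zero    = filter-zero
    filter-at (suc k) = NextFilter.filter-next k (filter-at k)

    all-rows-in : ∀ C → C ∈ sets p → Σ[ x ∈ X ] Good (proj₁ (above-all rank)) C x
    all-rows-in C C∈ = IsIdempotentFilter.inhabited isQ (good {C} C∈)
      where open FilterAt (filter-at (proj₁ (above-all rank)))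

  opaque
    image-in-member : (B : ℚMatrix) → ImagePartitionRegular B → (C : Pred ℕ⁺ 0ℓ) → C ∈ sets p →
      Σ[ x ∈ Vec ℕ⁺ (cols B) ] (∀ i → Σ[ n ∈ ℕ⁺ ] n ∈ C × Vec.lookup (image B x) i ≡ ι n)
    image-in-member B ipr C C∈ =
      let S = IPRStages.staged em B ipr
          y , entries-nat , rows-in = all-rows-in (coefficient B) S C C∈
          x = Vec.tabulate (λ l → proj₁ (entries-nat l))
      in x , λ i → let n , e , n∈ = rows-in i in
           n , n∈ (proj₂ (above-all (Staged.rank S)) i) ,
           trans (image-entry B x i) (trans
             (sum-cong-≗ λ l → cong (coefficient B i l ℚ.*_)
               (trans (cong ν (Vec.lookup∘tabulate (λ l → proj₁ (entries-nat l)) l)) (sym (proj₂ (entries-nat l)))))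
             (trans e (sym (ι≡ν n))))

-- Listings of finite sets.

_≟⁺_ : (m n : ℕ⁺) → Dec (m ≡ n)
m ≟⁺ n = map′ value-injective (cong value) (value m ℕ.≟ value n)

fromList : ∀ {X : Set} (xs : List X) {x} → x ∈ˡ xs → Unique xs → Σ[ F ∈ 𝒫f X ] elements F ≡ xs
fromList (x ∷ xs) _ u = record { listing = x ∷ xs ; unique = u } , refl

range : ∀ {k} → Fin k → (f : Fin k → ℕ⁺) → Σ[ F ∈ 𝒫f ℕ⁺ ] ⟦ F ⟧ ≐ (λ n → ∃[ i ] n ≡ f i)
range i f =
  let xs = List.deduplicate _≟⁺_ (List.tabulate f)
      F , F≡xs = fromList xs (∈-deduplicate⁺ _≟⁺_ (∈-tabulate⁺ {f = f} i)) (Unique.deduplicate-! _≟⁺_ (List.tabulate f))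
  in F ,
     (λ {n} n∈F → ∈-tabulate⁻ {f = f} (∈-deduplicate⁻ _≟⁺_ (List.tabulate f) (subst (n ∈ˡ_) F≡xs n∈F))) ,
     λ { {n} (j , refl) → subst (n ∈ˡ_) (sym F≡xs) (∈-deduplicate⁺ _≟⁺_ (∈-tabulate⁺ {f = f} j)) }

total : List ℕ → (ℕ → ℚ) → ℚ
total ts x = List.foldr ℚ._+_ 0ℚ (List.map x ts)

total-↭ : ∀ {ts us} → ts ↭ us → ∀ x → total ts x ≡ total us x
total-↭ ts↭us x = ↭ₛ.foldr-commMonoid (setoid ℚ) ℚ.+-0-isCommutativeMonoid (↭⇒↭ₛ (↭-map⁺ x ts↭us))

-- Sums do not depend on the order of the listing, so the indices may be taken in the order in which
-- the Yₙ are chosen.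
record Increasing (F : 𝒫f ℕ) : Set where
  field
    first      : ℕ
    others     : List ℕ
    increasing : AllPairs ℕ._<_ (first ∷ others)
    arranges   : (first ∷ others) ↭ elements F

increasing-listing : ∀ F → Increasing F
increasing-listing F = arrange (sort (elements F)) (sort-↭ (elements F))
  (AllPairs.zipWith (λ (m≤n , m≢n) → ℕ.≤∧≢⇒< m≤n m≢n)
    ( Linked⇒AllPairs ℕ.≤-trans (sort-↗ (elements F))
    , ↭ₛ.Unique-resp-↭ (setoid ℕ) (↭⇒↭ₛ (↭-sym (sort-↭ (elements F)))) (𝒫f.unique F)))
  where
  arrange : ∀ ts → ts ↭ elements F → AllPairs ℕ._<_ ts → Increasing F
  arrange [] []↭F _ = contradiction (∈-resp-↭ (↭-sym []↭F) (here refl)) λ ()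
  arrange (t ∷ ts) h inc = record { first = t ; others = ts ; increasing = inc ; arranges = h }

first-row : (B : ℚMatrix) → Fin (rows B)
first-row record { rows = k ; rows-nonZero = k≢0 } = fromℕ< (ℕ.>-nonZero⁻¹ k {{k≢0}})

-- The image 2q of q under doubling, not to be confused with q + q.
double : βℕ → βℕ
double q = record
  { sets    = λ A → (λ x → x +⁺ x ∈ A) ∈ sets q
  ; whole   = whole q
  ; proper  = proper q
  ; upward  = λ A⊆B → upward q A⊆B
  ; meet    = meet q
  ; maximal = λ A → maximal q (λ x → x +⁺ x ∈ A)
  }

-- Choosing the images Yₙ one at a time.

module Sequence (em : ExcludedMiddle (Level.suc 0ℓ)) (ext : Extensionality 0ℓ 0ℓ)
                (p : βℕ) (p-idem : p +ᵘ p ≈ᵘ p) (p-rec : Recurrent p)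
                (B : ℕ → ℚMatrix) (ipr : ∀ n → ImagePartitionRegular (B n)) where
  open CentralImages em ext p p-idem p-rec

  r : βℕ
  r = double p +ᵘ p

  double-regroup : ∀ x y w → ((x +⁺ y) +⁺ (x +⁺ y)) +⁺ w ≡ (x +⁺ x) +⁺ ((y +⁺ y) +⁺ w)
  double-regroup x y w = ν-injective (begin
    ν (((x +⁺ y) +⁺ (x +⁺ y)) +⁺ w)
      ≡⟨ trans (ν-+ ((x +⁺ y) +⁺ (x +⁺ y)) w) (cong (ℚ._+ ν w) (trans (ν-+ (x +⁺ y) (x +⁺ y)) (cong₂ ℚ._+_ (ν-+ x y) (ν-+ x y)))) ⟩
    ((ν x ℚ.+ ν y) ℚ.+ (ν x ℚ.+ ν y)) ℚ.+ ν w
      ≡⟨ solve 3 (λ x y w → ((x :+ y) :+ (x :+ y)) :+ w := (x :+ x) :+ ((y :+ y) :+ w)) refl (ν x) (ν y) (ν w) ⟩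
    (ν x ℚ.+ ν x) ℚ.+ ((ν y ℚ.+ ν y) ℚ.+ ν w)
      ≡⟨ trans (ν-+ (x +⁺ x) ((y +⁺ y) +⁺ w)) (cong₂ ℚ._+_ (ν-+ x x) (trans (ν-+ (y +⁺ y) w) (cong (ℚ._+ ν w) (ν-+ y y)))) ⟨
    ν ((x +⁺ x) +⁺ ((y +⁺ y) +⁺ w)) ∎)
    where
    open ≡-Reasoning
    open +-*-Solver

  -- 2p + 2p + p = 2p + p
  double-returns : ∀ {G} → G ∈ sets r → (λ x → - (x +⁺ x) +ˢ G ∈ sets r) ∈ sets p
  double-returns {G} G∈ = upward p (λ {x} → upward p λ {y} → upward p λ {w} →
      subst G (double-regroup x y w))
    (returns {λ x → - (x +⁺ x) +ˢ G ∈ sets p} G∈)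

  -- P constrains the sums still to be formed with coefficient 1, and G the
  -- sums 2 Σ_{F₀} + Σ_{F₁} still to be formed.
  record State : Set₁ where
    field
      P  : Pred ℕ⁺ 0ℓ
      P∈ : P ∈ sets p
      G  : Pred ℕ⁺ 0ℓ
      G∈ : G ∈ sets r
  open State

  -- The last two clauses provide for y as an element of F₀: if y is its last element a sum governed
  -- by p remains to be added, otherwise one governed by 2p + p.
  Admissible : State → Pred ℕ⁺ 0ℓ
  Admissible s y = y ∈ P s × - y +ˢ P s ∈ sets p × - (y +⁺ y) +ˢ G s ∈ sets p × - (y +⁺ y) +ˢ G s ∈ sets r

  admissible-member : ∀ s → Admissible s ∈ sets p
  admissible-member s = meet p (P∈ s) (meet p (returns {P s} (P∈ s)) (meet p (G∈ s) (double-returns {G s} (G∈ s))))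

  module Choice (n : ℕ) (s : State) where

    chosen : Σ[ x ∈ Vec ℕ⁺ (cols (B n)) ] (∀ i → Σ[ y ∈ ℕ⁺ ] y ∈ Admissible s × Vec.lookup (image (B n) x) i ≡ ι y)
    chosen = image-in-member (B n) (ipr n) (Admissible s) (admissible-member s)

    entry : Fin (rows (B n)) → ℕ⁺
    entry i = proj₁ (proj₂ chosen i)

    entry-admissible : ∀ i → entry i ∈ Admissible s
    entry-admissible i = proj₁ (proj₂ (proj₂ chosen i))

    entry-image : ∀ i → Vec.lookup (image (B n) (proj₁ chosen)) i ≡ ι (entry i)
    entry-image i = proj₂ (proj₂ (proj₂ chosen i))

    entries-set : Σ[ F ∈ 𝒫f ℕ⁺ ] ⟦ F ⟧ ≐ (λ y → ∃[ i ] y ≡ entry i)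
    entries-set = range (first-row (B n)) entry

    after : Fin (rows (B n)) → Pred ℕ⁺ 0ℓ
    after i = - (entry i +⁺ entry i) +ˢ G s

    next : State
    next = record
      -- The third condition allows F₁ to begin once the present index has closed F₀.
      { P  = λ z → z ∈ P s × (∀ i → entry i +⁺ z ∈ P s) × (∀ i → (entry i +⁺ entry i) +⁺ z ∈ G s)
      ; P∈ = meet p (P∈ s) (meet p (meet-all p λ i → proj₁ (proj₂ (entry-admissible i)))
                                   (meet-all p λ i → proj₁ (proj₂ (proj₂ (entry-admissible i)))))
      ; G  = λ z → z ∈ G s × (∀ i → z ∈ after i)
      ; G∈ = meet r {G s} {λ z → ∀ i → z ∈ after i} (G∈ s) (meet-all r {A = after} λ i → proj₂ (proj₂ (proj₂ (entry-admissible i))))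
      }

  module Run (s₀ : State) where

    state : ℕ → State
    state zero    = s₀
    state (suc n) = Choice.next n (state n)

    Y : ℕ → 𝒫f ℕ⁺
    Y n = proj₁ (Choice.entries-set n (state n))

    Y-entry : ∀ n {y} → y ∈ ⟦ Y n ⟧ → ∃[ i ] y ≡ Choice.entry n (state n) i
    Y-entry n = proj₁ (proj₂ (Choice.entries-set n (state n)))

    Y-image : ∀ n → Σ[ x ∈ Vec ℕ⁺ (cols (B n)) ] (ι⟦ ⟦ Y n ⟧ ⟧ ≐ entrySet (image (B n) x))
    Y-image n = proj₁ chosen ,
      (λ (y , y∈ , q≡) → let i , y≡ = Y-entry n y∈ in
        i , trans q≡ (trans (cong ι y≡) (sym (entry-image i)))) ,
      λ (i , q≡) → entry i , proj₂ (proj₂ entries-set) (i , refl) , trans q≡ (entry-image i)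
      where open Choice n (state n)

    Y⊆P : ∀ n {y} → y ∈ ⟦ Y n ⟧ → y ∈ P (state n)
    Y⊆P n y∈ = let i , y≡ = Y-entry n y∈ in
      subst (P (state n)) (sym y≡) (proj₁ (Choice.entry-admissible n (state n) i))

    Y+P : ∀ n {y z} → y ∈ ⟦ Y n ⟧ → z ∈ P (state (suc n)) → y +⁺ z ∈ P (state n)
    Y+P n {z = z} y∈ (_ , h , _) = let i , y≡ = Y-entry n y∈ in subst (λ y → P (state n) (y +⁺ z)) (sym y≡) (h i)

    2Y+P : ∀ n {y z} → y ∈ ⟦ Y n ⟧ → z ∈ P (state (suc n)) → (y +⁺ y) +⁺ z ∈ G (state n)
    2Y+P n {z = z} y∈ (_ , _ , h) = let i , y≡ = Y-entry n y∈ in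
      subst (λ y → G (state n) ((y +⁺ y) +⁺ z)) (sym y≡) (h i)

    2Y+G : ∀ n {y z} → y ∈ ⟦ Y n ⟧ → z ∈ G (state (suc n)) → (y +⁺ y) +⁺ z ∈ G (state n)
    2Y+G n {z = z} y∈ (_ , h) = let i , y≡ = Y-entry n y∈ in
      subst (λ y → G (state n) ((y +⁺ y) +⁺ z)) (sym y≡) (h i)

    P-decreasing : ∀ {m n} → m ℕ.≤′ n → P (state n) ⊆ P (state m)
    P-decreasing (ℕ.≤′-reflexive refl) h = h
    P-decreasing (ℕ.≤′-step m≤n) (h , _) = P-decreasing m≤n h

    G-decreasing : ∀ {m n} → m ℕ.≤′ n → G (state n) ⊆ G (state m)
    G-decreasing (ℕ.≤′-reflexive refl) h = h
    G-decreasing (ℕ.≤′-step m≤n) (h , _) = G-decreasing m≤n h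

    Chosen : (ℕ → ℚ) → Pred ℕ 0ℓ
    Chosen x t = x t ∈ ι⟦ ⟦ Y t ⟧ ⟧

    -- The sum over the later indices lies in P at stage t + 1, and `Y+P` adds the term of index t.
    -- Indices missing from the set are bridged by `P-decreasing`.
    sum-in-P : ∀ x t ts n → n ℕ.≤ t → AllPairs ℕ._<_ (t ∷ ts) → All (Chosen x) (t ∷ ts) →
               Σ[ m ∈ ℕ⁺ ] m ∈ P (state n) × total (t ∷ ts) x ≡ ν m
    sum-in-P x t [] n n≤t _ ((y , y∈ , e) ∷ []) =
      y , P-decreasing (ℕ.≤⇒≤′ n≤t) (Y⊆P t y∈) , trans (ℚ.+-identityʳ (x t)) (trans e (ι≡ν y))
    sum-in-P x t (t′ ∷ ts) n n≤t ((t<t′ ∷ _) ∷ inc) ((y , y∈ , e) ∷ cs) =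
      let m , m∈ , m≡ = sum-in-P x t′ ts (suc t) t<t′ inc cs in
      y +⁺ m , P-decreasing (ℕ.≤⇒≤′ n≤t) (Y+P t y∈ m∈) ,
      trans (cong₂ ℚ._+_ (trans e (ι≡ν y)) m≡) (sym (ν-+ y m))

    -- The last index of F₀ hands over to `sum-in-P` through `2Y+P`, since F₁ starts later; every
    -- earlier index is added through `2Y+G`.
    MT-sum-in-G : ∀ x t ts u us n → n ℕ.≤ t → AllPairs ℕ._<_ (t ∷ ts) → All (ℕ._< u) (t ∷ ts) →
                  AllPairs ℕ._<_ (u ∷ us) → All (Chosen x) (t ∷ ts) → All (Chosen x) (u ∷ us) →
                  Σ[ m ∈ ℕ⁺ ] m ∈ G (state n) × 2ℚ ℚ.* total (t ∷ ts) x ℚ.+ total (u ∷ us) x ≡ ν m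
    MT-sum-in-G x t [] u us n n≤t _ (t<u ∷ []) inc ((y , y∈ , e) ∷ []) ds =
      let m , m∈ , m≡ = sum-in-P x u us (suc t) t<u inc ds in
      (y +⁺ y) +⁺ m , G-decreasing (ℕ.≤⇒≤′ n≤t) (2Y+P t y∈ m∈) ,
      trans (cong₂ (λ a s → 2ℚ ℚ.* (a ℚ.+ 0ℚ) ℚ.+ s) (trans e (ι≡ν y)) m≡)
        (trans (solve 2 (λ y m → con 2ℚ :* (y :+ con 0ℚ) :+ m := (y :+ y) :+ m) refl (ν y) (ν m))
          (sym (trans (ν-+ (y +⁺ y) m) (cong (ℚ._+ ν m) (ν-+ y y)))))
      where open +-*-Solver
    MT-sum-in-G x t (t′ ∷ ts) u us n n≤t ((t<t′ ∷ _) ∷ inc) (_ ∷ below) inc′ ((y , y∈ , e) ∷ cs) ds =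
      let m , m∈ , m≡ = MT-sum-in-G x t′ ts u us (suc t) t<t′ inc below inc′ cs ds in
      (y +⁺ y) +⁺ m , G-decreasing (ℕ.≤⇒≤′ n≤t) (2Y+G t y∈ m∈) ,
      trans (cong (λ a → 2ℚ ℚ.* (a ℚ.+ total (t′ ∷ ts) x) ℚ.+ total (u ∷ us) x) (trans e (ι≡ν y)))
        (trans (solve 3 (λ y s s′ → con 2ℚ :* (y :+ s) :+ s′ := (y :+ y) :+ (con 2ℚ :* s :+ s′)) refl
                  (ν y) (total (t′ ∷ ts) x) (total (u ∷ us) x))
          (trans (cong ((ν y ℚ.+ ν y) ℚ.+_) m≡)
            (sym (trans (ν-+ (y +⁺ y) m) (cong (ℚ._+ ν m) (ν-+ y y))))))
      where open +-*-Solver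

    FS-in-P : ∀ {q} → q ∈ FS (λ n → ι⟦ ⟦ Y n ⟧ ⟧) → Σ[ m ∈ ℕ⁺ ] m ∈ P s₀ × q ≡ ν m
    FS-in-P (F , x , x∈ , q≡) =
      let m , m∈ , m≡ = sum-in-P x first others 0 ℕ.z≤n increasing (All.tabulate λ t∈ → x∈ (∈-resp-↭ arranges t∈))
      in m , m∈ , trans q≡ (trans (sym (total-↭ arranges x)) m≡)
      where open Increasing (increasing-listing F)

    MT-in-G : ∀ {q} → q ∈ MT₂₁ (λ n → ι⟦ ⟦ Y n ⟧ ⟧) → Σ[ m ∈ ℕ⁺ ] m ∈ G s₀ × q ≡ ν m
    MT-in-G (F₀ , F₁ , x , F₀≺F₁ , x∈ , q≡) =
      let m , m∈ , m≡ = MT-sum-in-G x I.first I.others J.first J.others 0 ℕ.z≤n I.increasing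
            (All.tabulate λ t∈ → F₀≺F₁ (∈-resp-↭ I.arranges t∈) (∈-resp-↭ J.arranges (here refl)))
            J.increasing
            (All.tabulate λ t∈ → x∈ (inj₁ (∈-resp-↭ I.arranges t∈)))
            (All.tabulate λ t∈ → x∈ (inj₂ (∈-resp-↭ J.arranges t∈)))
      in m , m∈ , trans q≡ (trans
           (cong₂ (λ a b → 2ℚ ℚ.* a ℚ.+ b) (sym (total-↭ I.arranges x)) (sym (total-↭ J.arranges x))) m≡)
      where
      module I = Increasing (increasing-listing F₀)
      module J = Increasing (increasing-listing F₁)

theorem6p6 : ExcludedMiddle (Level.suc 0ℓ) → Extensionality (Level.suc 0ℓ) (Level.suc 0ℓ) →
    (B : ℕ → ℚMatrix) → EnumeratesIPR B →
    (p : βℕ) → MinimalIdempotent p →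
    (A : Pred ℕ⁺ 0ℓ) → A ∈ sets p →
    Σ[ b ∈ ℕ⁺ ] Σ[ Y ∈ (ℕ → 𝒫f ℕ⁺) ]
    ((∀ n → Σ[ x ∈ Vec ℕ⁺ (cols (B n)) ] (ι⟦ ⟦ Y n ⟧ ⟧ ≐ entrySet (image (B n) x))) ×
    (FS (λ n → ι⟦ ⟦ Y n ⟧ ⟧) ∪ (ι b ⊕ MT₂₁ (λ n → ι⟦ ⟦ Y n ⟧ ⟧)) ⊆ ι⟦ A ⟧))
theorem6p6 em ext B (ipr , _) p p-min@(p-idem , _) A A∈p = b , Y , Y-image , λ
  { (inj₁ q∈FS) → let m , m∈A , q≡ = FS-in-P q∈FS in m , m∈A , trans q≡ (sym (ι≡ν m))
  ; (inj₂ (q′ , q′∈MT , q≡)) → let m , b+m∈A , q′≡ = MT-in-G q′∈MT in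
      b +⁺ m , b+m∈A ,
      trans q≡ (trans (cong₂ ℚ._+_ (ι≡ν b) q′≡) (trans (sym (ν-+ b m)) (sym (ι≡ν (b +⁺ m)))))
  }
  where
  ext₀ : Extensionality 0ℓ 0ℓ
  ext₀ = lower-extensionality (Level.suc 0ℓ) (Level.suc 0ℓ) ext
  p-rec : Recurrent p
  p-rec = Recurrence.minimal⇒recurrent em ext₀ p-min
  open Sequence em ext₀ p p-idem p-rec B ipr
  shifted : Σ[ b ∈ ℕ⁺ ] (- b +ˢ A ∈ sets r)
  -- Recurrence of p with x = 2p provides b.
  shifted = p-rec (double p) A A∈p
  b : ℕ⁺
  b = proj₁ shifted
  initial : State
  -- P starts as A for the finite sums, and G as -b + A for the sums to be translated by b.
  initial = record { P = A ; P∈ = A∈p ; G = - b +ˢ A ; G∈ = proj₂ shifted }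
  open Run initial
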